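{- For every field $K$ and every non-empty set $X$, the first-order theory of the free associative unitary algebra $\mathbb{A}_K(X)$, in the language of rings, is undecidable.
   Context: $\mathbb{A}_K(X)$ denotes the free associative unitary algebra over the field $K$ with free basis $X$ (the algebra of non-commutative polynomials in the variables $X$ with coefficients in $K$). It is regarded as a first-order structure in the language of rings $\{+,\cdot,0,1\}$. -}

module Defs where

open import Level using (Level; _⊔_; Lift)
import Level
open import Data.Nat using (ℕ; zero; suc; _+_)
import Data.Nat as ℕ
open import Data.Fin using (Fin; toℕ)
import Data.Fin as Fin
open import Data.Bool using (Bool; true; false)
open import Data.List using (List; []; _∷_; lookup; length)
open import Data.Maybe using (Maybe; just; nothing)
open import Data.Product using (Σ; ∃; _×_; _,_)
open import Data.Sum using (_⊎_)
open import Data.Empty using (⊥)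
open import Relation.Nullary using (¬_; yes; no)
open import Relation.Binary.PropositionalEquality using (_≡_)
open import Algebra.Bundles using (CommutativeRing)

record Field (c ℓ : Level) : Set (Level.suc (c ⊔ ℓ)) where
  field
    commutativeRing : CommutativeRing c ℓ
  open CommutativeRing commutativeRing public
  field
    1≉0     : ¬ (1# ≈ 0#)
    inverse : ∀ x → ¬ (x ≈ 0#) → Σ Carrier λ y → (x * y) ≈ 1#

-- The free associative unitary K-algebra A_K(X), presented as the term
-- algebra on scalars (elements of K) and generators (elements of X)
-- modulo the congruence generated by the axioms of a unitary associative
-- K-algebra (ring axioms, scalars form a central copy of K).

module FreeAlgebra {c ℓ x : Level} (K : Field c ℓ) (X : Set x) where
  private module K = Field K

  data Poly : Set (c ⊔ x) where
    scal : K.Carrier → Poly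
    gen  : X → Poly
    zer  : Poly
    one  : Poly
    _⊕_  : Poly → Poly → Poly
    _⊗_  : Poly → Poly → Poly
    neg  : Poly → Poly

  infixl 6 _⊕_
  infixl 7 _⊗_
  infix 4 _≈_

  data _≈_ : Poly → Poly → Set (c ⊔ ℓ ⊔ x) where
    refl  : ∀ {p} → p ≈ p
    sym   : ∀ {p q} → p ≈ q → q ≈ p
    trans : ∀ {p q r} → p ≈ q → q ≈ r → p ≈ r
    ⊕-cong   : ∀ {p p′ q q′} → p ≈ p′ → q ≈ q′ → p ⊕ q ≈ p′ ⊕ q′
    ⊗-cong   : ∀ {p p′ q q′} → p ≈ p′ → q ≈ q′ → p ⊗ q ≈ p′ ⊗ q′
    neg-cong : ∀ {p q} → p ≈ q → neg p ≈ neg q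
    ⊕-assoc  : ∀ p q r → (p ⊕ q) ⊕ r ≈ p ⊕ (q ⊕ r)
    ⊕-comm   : ∀ p q → p ⊕ q ≈ q ⊕ p
    ⊕-idˡ    : ∀ p → zer ⊕ p ≈ p
    neg-invˡ : ∀ p → neg p ⊕ p ≈ zer
    ⊗-assoc  : ∀ p q r → (p ⊗ q) ⊗ r ≈ p ⊗ (q ⊗ r)
    ⊗-idˡ    : ∀ p → one ⊗ p ≈ p
    ⊗-idʳ    : ∀ p → p ⊗ one ≈ p
    distribˡ : ∀ p q r → p ⊗ (q ⊕ r) ≈ (p ⊗ q) ⊕ (p ⊗ r)
    distribʳ : ∀ p q r → (q ⊕ r) ⊗ p ≈ (q ⊗ p) ⊕ (r ⊗ p)
    scal-cong : ∀ {a b} → a K.≈ b → scal a ≈ scal b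
    scal-+    : ∀ a b → scal (a K.+ b) ≈ scal a ⊕ scal b
    scal-*    : ∀ a b → scal (a K.* b) ≈ scal a ⊗ scal b
    scal-1    : scal K.1# ≈ one
    scal-central : ∀ a p → scal a ⊗ p ≈ p ⊗ scal a

  𝔸 : Set (c ⊔ x)
  𝔸 = Poly

data Term (n : ℕ) : Set where
  var  : Fin n → Term n
  `0 `1 : Term n
  _`+_ _`·_ : Term n → Term n → Term n

data Formula (n : ℕ) : Set where
  _`≡_ : Term n → Term n → Formula n
  `⊥   : Formula n
  _`∧_ _`∨_ _`⇒_ : Formula n → Formula n → Formula n
  `∀ `∃ : Formula (suc n) → Formula n

Sentence : Set
Sentence = Formula 0

record RingLangStructure (a e : Level) : Set (Level.suc (a ⊔ e)) where
  field
    U   : Set a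
    _≈ᵤ_ : U → U → Set e
    0ᵤ 1ᵤ : U
    _+ᵤ_ _·ᵤ_ : U → U → U

module Semantics {a e : Level} (M : RingLangStructure a e) where
  open RingLangStructure M

  Env : ℕ → Set a
  Env n = Fin n → U

  extend : ∀ {n} → U → Env n → Env (suc n)
  extend u ρ Fin.zero = u
  extend u ρ (Fin.suc i) = ρ i

  ⟦_⟧ₜ : ∀ {n} → Term n → Env n → U
  ⟦ var i ⟧ₜ ρ = ρ i
  ⟦ `0 ⟧ₜ ρ = 0ᵤ
  ⟦ `1 ⟧ₜ ρ = 1ᵤ
  ⟦ s `+ t ⟧ₜ ρ = ⟦ s ⟧ₜ ρ +ᵤ ⟦ t ⟧ₜ ρ
  ⟦ s `· t ⟧ₜ ρ = ⟦ s ⟧ₜ ρ ·ᵤ ⟦ t ⟧ₜ ρ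

  infix 4 _⊨_
  _⊨_ : ∀ {n} → Env n → Formula n → Set (a ⊔ e)
  ρ ⊨ (s `≡ t) = Lift a (⟦ s ⟧ₜ ρ ≈ᵤ ⟦ t ⟧ₜ ρ)
  ρ ⊨ `⊥ = Lift (a ⊔ e) ⊥
  ρ ⊨ (φ `∧ ψ) = (ρ ⊨ φ) × (ρ ⊨ ψ)
  ρ ⊨ (φ `∨ ψ) = (ρ ⊨ φ) ⊎ (ρ ⊨ ψ)
  ρ ⊨ (φ `⇒ ψ) = (ρ ⊨ φ) → (ρ ⊨ ψ)
  ρ ⊨ `∀ φ = (u : U) → extend u ρ ⊨ φ
  ρ ⊨ `∃ φ = Σ U λ u → extend u ρ ⊨ φ

  emptyEnv : Env 0
  emptyEnv ()

  Th : Sentence → Set (a ⊔ e)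
  Th φ = emptyEnv ⊨ φ

𝔸-structure : ∀ {c ℓ x} (K : Field c ℓ) (X : Set x) →
              RingLangStructure (c ⊔ x) (c ⊔ ℓ ⊔ x)
𝔸-structure K X = record
  { U = Poly ; _≈ᵤ_ = _≈_ ; 0ᵤ = zer ; 1ᵤ = one ; _+ᵤ_ = _⊕_ ; _·ᵤ_ = _⊗_ }
  where open FreeAlgebra K X

-- Gödel numbering of sentences (Cantor pairing).

triangle : ℕ → ℕ
triangle zero = zero
triangle (suc n) = suc n + triangle n

pair : ℕ → ℕ → ℕ
pair m n = triangle (m + n) + n

⌜_⌝ₜ : ∀ {n} → Term n → ℕ
⌜ var i ⌝ₜ = pair 0 (toℕ i)
⌜ `0 ⌝ₜ = pair 1 0
⌜ `1 ⌝ₜ = pair 2 0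
⌜ s `+ t ⌝ₜ = pair 3 (pair ⌜ s ⌝ₜ ⌜ t ⌝ₜ)
⌜ s `· t ⌝ₜ = pair 4 (pair ⌜ s ⌝ₜ ⌜ t ⌝ₜ)

⌜_⌝ : ∀ {n} → Formula n → ℕ
⌜ s `≡ t ⌝ = pair 0 (pair ⌜ s ⌝ₜ ⌜ t ⌝ₜ)
⌜ `⊥ ⌝ = pair 1 0
⌜ φ `∧ ψ ⌝ = pair 2 (pair ⌜ φ ⌝ ⌜ ψ ⌝)
⌜ φ `∨ ψ ⌝ = pair 3 (pair ⌜ φ ⌝ ⌜ ψ ⌝)
⌜ φ `⇒ ψ ⌝ = pair 4 (pair ⌜ φ ⌝ ⌜ ψ ⌝)
⌜ `∀ φ ⌝ = pair 5 ⌜ φ ⌝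
⌜ `∃ φ ⌝ = pair 6 ⌜ φ ⌝

-- Model of computation: (Minsky) register machines.
-- Registers are indexed by ℕ; the program counter points into the
-- instruction list and the machine halts when it leaves the list.
--   inc r j    : increment register r, go to instruction j
--   dec r j k  : if register r is 0 go to j, else decrement it and go to k

data Instr : Set where
  inc : ℕ → ℕ → Instr
  dec : ℕ → ℕ → ℕ → Instr

Program : Set
Program = List Instr

Registers : Set
Registers = ℕ → ℕ

update : Registers → ℕ → ℕ → Registers
update R r v s with s ℕ.≟ r
... | yes _ = v
... | no  _ = R s

fetch : Program → ℕ → Maybe Instr
fetch [] _ = nothing
fetch (i ∷ is) zero = just i
fetch (i ∷ is) (suc n) = fetch is n

runFrom : Program → ℕ → ℕ → Registers → Maybe ℕ
runFrom P k pc R with fetch P pc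
runFrom P k       pc R | nothing = just (R 0)
runFrom P zero    pc R | just _  = nothing
runFrom P (suc k) pc R | just (inc r j) = runFrom P k j (update R r (suc (R r)))
runFrom P (suc k) pc R | just (dec r j l) with R r
... | zero  = runFrom P k j R
... | suc v = runFrom P k l (update R r v)

run : Program → ℕ → ℕ → Maybe ℕ
run P k n = runFrom P k 0 (λ { zero → n ; (suc _) → 0 })

DecidableTheory : ∀ {t} → (Sentence → Set t) → Set t
DecidableTheory T =
  Σ Program λ P → (φ : Sentence) → Σ ℕ λ k → Σ ℕ λ o →
    (run P k ⌜ φ ⌝ ≡ just o) × ((o ≡ 1 → T φ) × (T φ → o ≡ 1))

{-# OPTIONS --safe #-}
module Submission where

-- Suppose that P decides the theory. A machine substitution-then-P turns the number of a formula θ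
-- into the number of θ applied to its own number and runs P on it; its states are coded by
-- natural numbers so that each transition is a finite set of maps a k + b ↦ c k + d. The formula θ
-- says that some set of powers of some element x contains the code of the initial state, is
-- closed under these maps, and contains no accepting code; so θ at its own number holds iff P
-- does not accept it. If P accepts, such a set would follow the computation into acceptance,
-- whatever x and the set are. If P does not, the trace of the computation is a finite set, and it
-- remains to define finite sets of powers of a generator x, uniformly in K and X.
--
-- The elements commuting with x are the polynomials in x: if δ is the linear map erasing the first
-- letter of each non-constant monomial, then applying δ to p x = x p gives p = p(0) + δ(p) x.
-- Sending all generators to one variable T, divisors of T ^ N congruent to 1 modulo T − 1 are powers of T,
-- and a set F ⊆ {0, …, N} is recovered from w = ∏ (1 + T ^ n v), n ∈ F, as the set of n such that
-- 1 + T ^ n v divides w, if v is chosen so that these factors are pairwise coprime.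
--
-- Equality in K and X need not be decidable; case distinctions take place under a double negation.

open import Defs
open import Level using (Level; _⊔_; lift; lower)
open import Algebra.Bundles using (Ring; CommutativeRing; Semiring)
open import Data.Nat using (ℕ; zero; suc; _≤_; _<_; z≤n; s≤s; _!)
import Data.Nat as ℕ
import Data.Nat.Properties as ℕ
open import Data.Nat.Divisibility using (_∣_; divides; ∣n⇒∣m*n; m∣m*n; ∣m+n∣m⇒∣n; ∣1⇒≡1; ∣-trans;
  ∣⇒≤; m≤n⇒m!∣n!)
open import Data.Nat.DivMod using (m≡m%n+[m/n]*n; m%n<n; [m+kn]%n≡m%n; m<n⇒m%n≡m)
open import Data.Nat.Coprimality using (Coprime; coprime-divisor)
import Data.Nat.Coprimality as Coprimality
open import Data.Nat.Tactic.RingSolver using (solve-∀)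
open import Data.Fin using (Fin; #_)
import Data.Fin as Fin
open import Data.List using (List; []; _∷_; _++_; length; map; upTo)
open import Data.List.Properties using (length-++; length-map)
open import Data.List.Extrema ℕ.≤-totalOrder using (max; xs≤max)
open import Data.List.Membership.DecPropositional ℕ._≟_ using (_∈?_)
open import Data.List.Membership.Propositional using (_∈_)
open import Data.List.Membership.Propositional.Properties using (∈-++⁺ˡ; ∈-++⁺ʳ; ∈-++⁻; ∈-map⁺;
  ∈-map⁻; ∈-upTo⁺; ∈-upTo⁻)
open import Data.List.Relation.Unary.All using (lookup)
open import Data.List.Relation.Unary.Any using (here; there)
open import Data.Maybe using (just; nothing)
open import Data.Maybe.Properties using (just-injective)
open import Data.Unit using (⊤; tt)
open import Data.Empty using (⊥; ⊥-elim)
open import Data.Product using (Σ; _×_; _,_; proj₁; proj₂)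
open import Data.Sum using (_⊎_; inj₁; inj₂)
open import Relation.Nullary using (¬_; yes; no)
open import Relation.Nullary.Decidable using (¬¬-excluded-middle)
open import Relation.Binary.Definitions using (tri<; tri≈; tri>)
open import Relation.Binary.PropositionalEquality as ≡ using (_≡_)
import Relation.Binary.Reasoning.Setoid as SetoidReasoning

-- The free algebra and its skew derivation

module FreeAlgebraRing {c ℓ x : Level} (K : Field c ℓ) (X : Set x) where
  open FreeAlgebra K X

  ring : Ring (c ⊔ x) (c ⊔ ℓ ⊔ x)
  ring = record
    { Carrier = Poly ; _≈_ = _≈_ ; _+_ = _⊕_ ; _*_ = _⊗_ ; -_ = neg ; 0# = zer ; 1# = one
    ; isRing = record
      { +-isAbelianGroup = record
        { isGroup = record
          { isMonoid = record
            { isSemigroup = record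
              { isMagma = record
                { isEquivalence = record { refl = refl ; sym = sym ; trans = trans }
                ; ∙-cong = ⊕-cong }
              ; assoc = ⊕-assoc }
            ; identity = ⊕-idˡ , λ p → trans (⊕-comm p zer) (⊕-idˡ p) }
          ; inverse = neg-invˡ , λ p → trans (⊕-comm p (neg p)) (neg-invˡ p)
          ; ⁻¹-cong = neg-cong }
        ; comm = ⊕-comm }
      ; *-cong = ⊗-cong ; *-assoc = ⊗-assoc ; *-identity = ⊗-idˡ , ⊗-idʳ
      ; distrib = distribˡ , distribʳ } }

-- The universal property of A_K(X): σ makes R a K-algebra.
module UniversalProperty {c ℓ x r s : Level} (K : Field c ℓ) (X : Set x) (R : Ring r s)
    (σ : Field.Carrier K → Ring.Carrier R)
    (σ-cong : ∀ {a b} → Field._≈_ K a b → Ring._≈_ R (σ a) (σ b))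
    (σ-+ : ∀ a b → Ring._≈_ R (σ (Field._+_ K a b)) (Ring._+_ R (σ a) (σ b)))
    (σ-* : ∀ a b → Ring._≈_ R (σ (Field._*_ K a b)) (Ring._*_ R (σ a) (σ b)))
    (σ-1 : Ring._≈_ R (σ (Field.1# K)) (Ring.1# R))
    (σ-central : ∀ a p → Ring._≈_ R (Ring._*_ R (σ a) p) (Ring._*_ R p (σ a)))
    (γ : X → Ring.Carrier R) where
  open FreeAlgebra K X
  private module R = Ring R

  eval : Poly → R.Carrier
  eval (scal a) = σ a
  eval (gen y)  = γ y
  eval zer      = R.0#
  eval one      = R.1#
  eval (p ⊕ q)  = eval p R.+ eval q
  eval (p ⊗ q)  = eval p R.* eval q
  eval (neg p)  = R.- eval p

  eval-cong : ∀ {p q} → p ≈ q → eval p R.≈ eval q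
  eval-cong refl             = R.refl
  eval-cong (sym e)          = R.sym (eval-cong e)
  eval-cong (trans d e)      = R.trans (eval-cong d) (eval-cong e)
  eval-cong (⊕-cong d e)     = R.+-cong (eval-cong d) (eval-cong e)
  eval-cong (⊗-cong d e)     = R.*-cong (eval-cong d) (eval-cong e)
  eval-cong (neg-cong e)     = R.-‿cong (eval-cong e)
  eval-cong (⊕-assoc p q r)  = R.+-assoc _ _ _
  eval-cong (⊕-comm p q)     = R.+-comm _ _
  eval-cong (⊕-idˡ p)        = R.+-identityˡ _
  eval-cong (neg-invˡ p)     = R.-‿inverseˡ _
  eval-cong (⊗-assoc p q r)  = R.*-assoc _ _ _
  eval-cong (⊗-idˡ p)        = R.*-identityˡ _
  eval-cong (⊗-idʳ p)        = R.*-identityʳ _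
  eval-cong (distribˡ p q r) = R.distribˡ _ _ _
  eval-cong (distribʳ p q r) = R.distribʳ _ _ _
  eval-cong (scal-cong e)    = σ-cong e
  eval-cong (scal-+ a b)     = σ-+ a b
  eval-cong (scal-* a b)     = σ-* a b
  eval-cong scal-1           = σ-1
  eval-cong (scal-central a p) = σ-central a _

module Evaluation {c ℓ x : Level} (K : Field c ℓ) (X : Set x) where
  private module K = Field K
  module At (γ : X → K.Carrier) = UniversalProperty K X K.ring (λ a → a) (λ e → e)
    (λ _ _ → K.refl) (λ _ _ → K.refl) K.refl K.*-comm γ

module Rename {c ℓ x y : Level} (K : Field c ℓ) (X : Set x) (Y : Set y) where
  private module Y = FreeAlgebra K Y
  module Along (f : X → Y) = UniversalProperty K X (FreeAlgebraRing.ring K Y) Y.scal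
    Y.scal-cong Y.scal-+ Y.scal-* Y.scal-1 Y.scal-central (λ z → Y.gen (f z))

-- δ is the left (0 , ε)-skew derivation with δ y = 1 for every generator y:
-- for p = ε p + Σ y p_y it returns Σ p_y.
module Derivation {c ℓ x : Level} (K : Field c ℓ) (X : Set x) where
  open FreeAlgebra K X
  private module K = Field K
  open Ring (FreeAlgebraRing.ring K X) using (setoid; +-identityʳ; zeroˡ; zeroʳ; *-congˡ; *-congʳ;
    +-congˡ; +-congʳ; -‿inverseʳ; +-commutativeSemigroup)
  open import Algebra.Properties.CommutativeSemigroup +-commutativeSemigroup using (interchange)
  open import Algebra.Properties.Ring (FreeAlgebraRing.ring K X)
    using (+-inverseˡ-unique; -1*x≈-x)
  open SetoidReasoning setoid
  open Evaluation.At K X (λ _ → K.0#) public renaming (eval to ε; eval-cong to ε-cong)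

  scal-0 : scal K.0# ≈ zer
  scal-0 = begin
    scal K.0#                                        ≈⟨ +-identityʳ _ ⟨
    scal K.0# ⊕ zer                                  ≈⟨ +-congˡ (-‿inverseʳ _) ⟨
    scal K.0# ⊕ (scal K.0# ⊕ neg (scal K.0#))        ≈⟨ ⊕-assoc _ _ _ ⟨
    (scal K.0# ⊕ scal K.0#) ⊕ neg (scal K.0#)        ≈⟨ +-congʳ (scal-+ _ _) ⟨
    scal (K.0# K.+ K.0#) ⊕ neg (scal K.0#)           ≈⟨ +-congʳ (scal-cong (K.+-identityʳ _)) ⟩
    scal K.0# ⊕ neg (scal K.0#)                      ≈⟨ -‿inverseʳ _ ⟩
    zer                                              ∎

  scal-neg : ∀ a → scal (K.- a) ≈ neg (scal a)
  scal-neg a = +-inverseˡ-unique _ _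
    (trans (sym (scal-+ _ _)) (trans (scal-cong (K.-‿inverseˡ a)) scal-0))

  δ : Poly → Poly
  δ (scal a) = zer
  δ (gen y)  = one
  δ zer      = zer
  δ one      = zer
  δ (p ⊕ q)  = δ p ⊕ δ q
  δ (p ⊗ q)  = δ p ⊗ q ⊕ scal (ε p) ⊗ δ q
  δ (neg p)  = neg (δ p)

  private
    zer⊕ : ∀ {p q r} → p ≈ zer → q ≈ r → p ⊕ q ≈ r
    zer⊕ e f = trans (⊕-cong e f) (⊕-idˡ _)

    ⊕zer : ∀ {p q r} → p ≈ r → q ≈ zer → p ⊕ q ≈ r
    ⊕zer e f = trans (⊕-cong e f) (+-identityʳ _)

    scal0* : ∀ {a} p → a K.≈ K.0# → scal a ⊗ p ≈ zer
    scal0* p e = trans (*-congʳ (trans (scal-cong e) scal-0)) (zeroˡ p)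

  -- `δ` is no ring homomorphism, so the universal property does not supply it; each axiom of the
  -- congruence is checked against the twisted Leibniz rule.
  δ-cong : ∀ {p q} → p ≈ q → δ p ≈ δ q
  δ-cong refl          = refl
  δ-cong (sym e)       = sym (δ-cong e)
  δ-cong (trans d e)   = trans (δ-cong d) (δ-cong e)
  δ-cong (⊕-cong d e)  = ⊕-cong (δ-cong d) (δ-cong e)
  δ-cong (⊗-cong d e)  = ⊕-cong (⊗-cong (δ-cong d) e) (⊗-cong (scal-cong (ε-cong d)) (δ-cong e))
  δ-cong (neg-cong e)  = neg-cong (δ-cong e)
  δ-cong (⊕-assoc p q r) = ⊕-assoc _ _ _
  δ-cong (⊕-comm p q)  = ⊕-comm _ _
  δ-cong (⊕-idˡ p)     = ⊕-idˡ _
  δ-cong (neg-invˡ p)  = neg-invˡ _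
  δ-cong (⊗-assoc p q r) = begin
    (δ p ⊗ q ⊕ scal (ε p) ⊗ δ q) ⊗ r ⊕ scal (ε p K.* ε q) ⊗ δ r
      ≈⟨ ⊕-cong (distribʳ _ _ _) (*-congʳ (scal-* _ _)) ⟩
    (δ p ⊗ q ⊗ r ⊕ scal (ε p) ⊗ δ q ⊗ r) ⊕ scal (ε p) ⊗ scal (ε q) ⊗ δ r
      ≈⟨ ⊕-cong (⊕-cong (⊗-assoc _ _ _) (⊗-assoc _ _ _)) (⊗-assoc _ _ _) ⟩
    (δ p ⊗ (q ⊗ r) ⊕ scal (ε p) ⊗ (δ q ⊗ r)) ⊕ scal (ε p) ⊗ (scal (ε q) ⊗ δ r)
      ≈⟨ ⊕-assoc _ _ _ ⟩
    δ p ⊗ (q ⊗ r) ⊕ (scal (ε p) ⊗ (δ q ⊗ r) ⊕ scal (ε p) ⊗ (scal (ε q) ⊗ δ r))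
      ≈⟨ +-congˡ (distribˡ _ _ _) ⟨
    δ p ⊗ (q ⊗ r) ⊕ scal (ε p) ⊗ (δ q ⊗ r ⊕ scal (ε q) ⊗ δ r) ∎
  δ-cong (⊗-idˡ p)     = zer⊕ (zeroˡ p) (trans (*-congʳ scal-1) (⊗-idˡ _))
  δ-cong (⊗-idʳ p)     = ⊕zer (⊗-idʳ _) (zeroʳ _)
  δ-cong (distribˡ p q r) = trans (⊕-cong (distribˡ _ _ _) (distribˡ _ _ _)) (interchange _ _ _ _)
  δ-cong (distribʳ p q r) = trans
    (⊕-cong (distribʳ _ _ _) (trans (*-congʳ (scal-+ _ _)) (distribʳ _ _ _))) (interchange _ _ _ _)
  δ-cong (scal-cong e) = refl
  δ-cong (scal-+ a b)  = sym (⊕-idˡ _)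
  δ-cong (scal-* a b)  = sym (zer⊕ (zeroˡ _) (zeroʳ _))
  δ-cong scal-1        = refl
  δ-cong (scal-central a p) = begin
    zer ⊗ p ⊕ scal a ⊗ δ p        ≈⟨ zer⊕ (zeroˡ _) (scal-central _ _) ⟩
    δ p ⊗ scal a                  ≈⟨ ⊕zer refl (zeroʳ _) ⟨
    δ p ⊗ scal a ⊕ scal (ε p) ⊗ zer ∎

  δ^ : ℕ → Poly → Poly
  δ^ zero    p = p
  δ^ (suc n) p = δ^ n (δ p)

  δ^-cong : ∀ n {p q} → p ≈ q → δ^ n p ≈ δ^ n q
  δ^-cong zero    e = e
  δ^-cong (suc n) e = δ^-cong n (δ-cong e)

  δ^-⊕ : ∀ n p q → δ^ n (p ⊕ q) ≈ δ^ n p ⊕ δ^ n q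
  δ^-⊕ zero    p q = refl
  δ^-⊕ (suc n) p q = δ^-⊕ n (δ p) (δ q)

  δ^-zer : ∀ n → δ^ n zer ≈ zer
  δ^-zer zero    = refl
  δ^-zer (suc n) = δ^-zer n

  δ^-scal : ∀ n a q → δ^ n (scal a ⊗ q) ≈ scal a ⊗ δ^ n q
  δ^-scal zero    a q = refl
  δ^-scal (suc n) a q = trans (δ^-cong n (zer⊕ (zeroˡ _) refl)) (δ^-scal n a (δ q))

  δ^-suc : ∀ n p → δ^ (suc n) p ≡ δ (δ^ n p)
  δ^-suc zero    p = ≡.refl
  δ^-suc (suc n) p = δ^-suc n (δ p)

  -- In one variable: p has degree at most n, and its coefficient in degree n is a.
  Top : ℕ → Poly → K.Carrier → Set (c ⊔ ℓ ⊔ x)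
  Top n p a = δ^ n p ≈ scal a

  Top-resp : ∀ {n p q a} → p ≈ q → Top n p a → Top n q a
  Top-resp {n} e t = trans (δ^-cong n (sym e)) t

  Top-raise : ∀ {n p a} → Top n p a → Top (suc n) p K.0#
  Top-raise {n} {p} t rewrite δ^-suc n p = trans (δ-cong t) (sym scal-0)

  Top-weaken : ∀ {n p} k → Top n p K.0# → Top (k ℕ.+ n) p K.0#
  Top-weaken zero    t = t
  Top-weaken (suc k) t = Top-raise {k ℕ.+ _} (Top-weaken k t)

  Top-⊕ : ∀ {n p q a b} → Top n p a → Top n q b → Top n (p ⊕ q) (a K.+ b)
  Top-⊕ {n} s t = trans (δ^-⊕ n _ _) (trans (⊕-cong s t) (sym (scal-+ _ _)))

  Top-cast : ∀ {n p a b} → a K.≈ b → Top n p a → Top n p b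
  Top-cast e t = trans t (scal-cong e)

  -- Induction on m by the twisted Leibniz rule: `δ p ⊗ q` lowers the degree of the first factor by
  -- one, and `scal (ε p) ⊗ δ q` contributes nothing, since q is killed by n + 2 applications of
  -- `δ`.
  Top-⊗ : ∀ m {n p q a b} → Top m p a → Top n q b → Top (m ℕ.+ n) (p ⊗ q) (a K.* b)
  Top-⊗ zero {n} {p} {q} s t = trans (δ^-cong n (*-congʳ s))
    (trans (δ^-scal n _ q) (trans (*-congˡ t) (sym (scal-* _ _))))
  Top-⊗ (suc m) {n} {p} {q} s t = trans (δ^-⊕ (m ℕ.+ n) _ _) (⊕zer (Top-⊗ m s t) (begin
    δ^ (m ℕ.+ n) (scal (ε p) ⊗ δ q)  ≈⟨ δ^-scal (m ℕ.+ n) _ _ ⟩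
    scal (ε p) ⊗ δ^ (suc (m ℕ.+ n)) q
      ≡⟨ ≡.cong (λ k → scal (ε p) ⊗ δ^ k q) (≡.sym (ℕ.+-suc m n)) ⟩
    scal (ε p) ⊗ δ^ (m ℕ.+ suc n) q
      ≈⟨ *-congˡ (Top-weaken m (Top-raise {n} {q} t)) ⟩
    scal (ε p) ⊗ scal K.0#           ≈⟨ *-congˡ scal-0 ⟩
    scal (ε p) ⊗ zer                 ≈⟨ zeroʳ _ ⟩
    zer                              ∎))

  -- A strict upper bound read off the expression; the exact degree would depend on deciding which
  -- coefficients vanish.
  degree : ∀ p → Σ ℕ λ n → Top n p K.0#
  degree (scal a) = 1 , sym scal-0
  degree (gen y)  = 2 , sym scal-0
  degree zer      = 0 , sym scal-0
  degree one      = 1 , sym scal-0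
  degree (p ⊕ q) with degree p | degree q
  ... | m , s | n , t = m ℕ.+ n , Top-cast {m ℕ.+ n} (K.+-identityʳ _) (Top-⊕ {m ℕ.+ n}
    (≡.subst (λ k → Top k p K.0#) (ℕ.+-comm n m) (Top-weaken n s)) (Top-weaken m t))
  degree (p ⊗ q) with degree p | degree q
  ... | m , s | n , t = m ℕ.+ n , Top-cast {m ℕ.+ n} (K.zeroˡ _) (Top-⊗ m s t)
  degree (neg p) with degree p
  ... | n , t = n , trans (δ^-cong n (sym (-1*p p))) (trans (δ^-scal n _ p)
    (trans (*-congˡ (trans t scal-0)) (trans (zeroʳ _) (sym scal-0))))
    where
    -1*p : ∀ p → scal (K.- K.1#) ⊗ p ≈ neg p
    -1*p p = trans (*-congʳ (trans (scal-neg _) (neg-cong scal-1))) (-1*x≈-x p)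

  -- One step of Horner's scheme. The condition passes to `δ p`, so iterating it writes p as a
  -- polynomial in y.
  Univariate : X → Poly → Set (c ⊔ ℓ ⊔ x)
  Univariate y p = p ≈ scal (ε p) ⊕ δ p ⊗ gen y

  Univariate-δ : ∀ {y p} → Univariate y p → Univariate y (δ p)
  Univariate-δ {y} {p} e = begin
    δ p                                                  ≈⟨ δ-cong e ⟩
    zer ⊕ (δ (δ p) ⊗ gen y ⊕ scal (ε (δ p)) ⊗ one)       ≈⟨ ⊕-idˡ _ ⟩
    δ (δ p) ⊗ gen y ⊕ scal (ε (δ p)) ⊗ one               ≈⟨ +-congˡ (⊗-idʳ _) ⟩
    δ (δ p) ⊗ gen y ⊕ scal (ε (δ p))                     ≈⟨ ⊕-comm _ _ ⟩
    scal (ε (δ p)) ⊕ δ (δ p) ⊗ gen y                     ∎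

  -- Apply δ to p x = x p.
  centralizer-Univariate : ∀ {y p} → p ⊗ gen y ≈ gen y ⊗ p → Univariate y p
  centralizer-Univariate {y} {p} e = begin
    p                               ≈⟨ ⊕zer (⊗-idˡ p) (scal0* (δ p) K.refl) ⟨
    δ (gen y ⊗ p)                   ≈⟨ δ-cong e ⟨
    δ p ⊗ gen y ⊕ scal (ε p) ⊗ one  ≈⟨ +-congˡ (⊗-idʳ _) ⟩
    δ p ⊗ gen y ⊕ scal (ε p)        ≈⟨ ⊕-comm _ _ ⟩
    scal (ε p) ⊕ δ p ⊗ gen y        ∎

-- One variable

module OneVariable {c ℓ : Level} (K : Field c ℓ) where
  open FreeAlgebra K ⊤ public
  open Derivation K ⊤ public
  private module K = Field K
  open Ring (FreeAlgebraRing.ring K ⊤) using (setoid; zeroˡ; zeroʳ; *-congˡ; *-congʳ; +-congˡ; +-congʳ)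
  open import Algebra.Properties.Ring (FreeAlgebraRing.ring K ⊤) using (-‿distribˡ-*; -‿distribʳ-*)

  T : Poly
  T = gen tt

  private
    comm-by-⊗ : ∀ {p q r} → p ⊗ r ≈ r ⊗ p → q ⊗ r ≈ r ⊗ q → (p ⊗ q) ⊗ r ≈ r ⊗ (p ⊗ q)
    comm-by-⊗ d e = trans (⊗-assoc _ _ _) (trans (*-congˡ e) (trans (sym (⊗-assoc _ _ _))
      (trans (*-congʳ d) (⊗-assoc _ _ _))))

    comm-by : ∀ q → T ⊗ q ≈ q ⊗ T → ∀ p → p ⊗ q ≈ q ⊗ p
    comm-by q t (scal a) = scal-central a q
    comm-by q t (gen tt) = t
    comm-by q t zer      = trans (zeroˡ _) (sym (zeroʳ _))
    comm-by q t one      = trans (⊗-idˡ _) (sym (⊗-idʳ _))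
    comm-by q t (p ⊕ r)  = trans (distribʳ _ _ _)
      (trans (⊕-cong (comm-by q t p) (comm-by q t r)) (sym (distribˡ _ _ _)))
    comm-by q t (p ⊗ r)  = comm-by-⊗ (comm-by q t p) (comm-by q t r)
    comm-by q t (neg p)  = trans (sym (-‿distribˡ-* _ _))
      (trans (neg-cong (comm-by q t p)) (-‿distribʳ-* _ _))

  -- What commutes with the generator T commutes with everything. Applied to T this shows that q
  -- commutes with T, and then it applies to q.
  ⊗-comm : ∀ p q → p ⊗ q ≈ q ⊗ p
  ⊗-comm p q = comm-by q (sym (comm-by T refl q)) p

  commutativeRing : CommutativeRing c (c ⊔ ℓ)
  commutativeRing = record { isCommutativeRing = record
    { isRing = Ring.isRing (FreeAlgebraRing.ring K ⊤) ; *-comm = ⊗-comm } }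

  open CommutativeRing commutativeRing using (commutativeSemiring)
  open import Algebra.Properties.CommutativeSemiring.Exp commutativeSemiring public
  open SetoidReasoning setoid

  expand : ∀ p → p ≈ scal (ε p) ⊕ δ p ⊗ T
  expand p = centralizer-Univariate (⊗-comm p T)

  -- `δ` undoes multiplication by T on the left, because `ε T` is 0.
  T-cancelʳ : ∀ {p q} → p ⊗ T ≈ q ⊗ T → p ≈ q
  T-cancelʳ {p} {q} e = trans (shift p) (trans (δ-cong (trans (⊗-comm T p) (trans e (⊗-comm q T))))
    (sym (shift q)))
    where
    shift : ∀ p → p ≈ δ (T ⊗ p)
    shift p = sym (trans (⊕-cong (⊗-idˡ p) (trans (*-congʳ scal-0) (zeroˡ _)))
      (trans (⊕-comm _ _) (⊕-idˡ p)))

  scal-injective : ∀ {a b} → scal a ≈ scal b → a K.≈ b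
  scal-injective = ε-cong

  K-domain : ∀ {a b} → a K.* b K.≈ K.0# → ¬ a K.≈ K.0# → b K.≈ K.0#
  K-domain {a} {b} e a≉0 with K.inverse a a≉0
  ... | a⁻¹ , f = K.trans (K.sym (K.*-identityˡ b)) (K.trans (K.*-congʳ (K.trans (K.sym f) (K.*-comm _ _)))
    (K.trans (K.*-assoc _ _ _) (K.trans (K.*-congˡ e) (K.zeroʳ _))))

  -- In degree 0 the coefficient may vanish, so that the zero polynomial is covered as well.
  Leading : Poly → Set (c ⊔ ℓ)
  Leading p = Σ ℕ λ n → Σ K.Carrier λ a → Top n p a × (n ≡ 0 ⊎ ¬ a K.≈ K.0#)

  -- The bound from `degree` is lowered as long as the coefficient there is 0; each of these tests
  -- is made under a double negation.
  leading : ∀ p → ¬ ¬ Leading p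
  leading p = descend (proj₁ (degree p)) (proj₂ (degree p))
    where
    descend : ∀ n {a} → Top n p a → ¬ ¬ Leading p
    descend zero    t k = k (0 , _ , t , inj₁ ≡.refl)
    descend (suc n) {a} t k = ¬¬-excluded-middle λ where
      (no a≉0)  → k (suc n , a , t , inj₂ a≉0)
      (yes a≈0) → descend n (trans (expand (δ^ n p)) (trans
        (+-congˡ (trans (*-congʳ (trans (≡.subst (λ r → r ≈ scal a) (δ^-suc n p) t)
          (trans (scal-cong a≈0) scal-0))) (zeroˡ _)))
        (trans (⊕-comm _ _) (⊕-idˡ _)))) k

  one≉zer : ¬ one ≈ zer
  one≉zer e = K.1≉0 (ε-cong e)

  Top-one : ∀ n → Top (suc n) one K.0#
  Top-one n = trans (δ^-zer n) (sym scal-0)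

  -- If p had positive degree, the product of the leading coefficients of p and q would be the
  -- coefficient of `one` in a positive degree, hence 0, although both are nonzero.
  unit-constant : ∀ {p q} → p ⊗ q ≈ one → ¬ ¬ (Σ K.Carrier λ a → p ≈ scal a)
  unit-constant {p} {q} e k = leading p λ { (m , a , s , s′) → leading q λ { (n , b , t , t′) →
    go m n s s′ t t′ } }
    where
    q≉zer : ¬ q ≈ zer
    q≉zer q≈0 = one≉zer (trans (sym e) (trans (*-congˡ q≈0) (zeroʳ p)))
    go : ∀ m n {a b} → Top m p a → m ≡ 0 ⊎ ¬ a K.≈ K.0# → Top n q b → n ≡ 0 ⊎ ¬ b K.≈ K.0# → ⊥
    go zero    n s s′ t t′ = k (_ , s)
    go (suc m) n s (inj₂ a≉0) t t′ = b≉0 n t t′ (K-domain (scal-injective (trans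
      (sym (Top-resp {suc (m ℕ.+ n)} e (Top-⊗ (suc m) s t))) (Top-one (m ℕ.+ n)))) a≉0)
      where
      b≉0 : ∀ n {b} → Top n q b → n ≡ 0 ⊎ ¬ b K.≈ K.0# → ¬ b K.≈ K.0#
      -- In degree 0 the coefficient is q itself, which is nonzero as a divisor of `one`.
      b≉0 zero    t (inj₁ _) b≈0 = q≉zer (trans t (trans (scal-cong b≈0) scal-0))
      b≉0 n       t (inj₂ b≉0)   = b≉0

  -- Induction on n: in T ^ (n + 1) = p h the constant term of p or of h vanishes, so one factor T
  -- can be cancelled from that side.
  factor-of-T^ : ∀ n {p h} → p ⊗ h ≈ T ^ n → ¬ ¬ (Σ K.Carrier λ a → Σ ℕ λ k → p ≈ scal a ⊗ T ^ k)
  factor-of-T^ zero    e k = unit-constant e λ { (a , f) → k (a , 0 , trans f (sym (⊗-idʳ _))) }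
  factor-of-T^ (suc n) {p} {h} e k = ¬¬-excluded-middle λ where
      (yes ε≈0) → factor-of-T^ n (T-cancelʳ (begin
          δ p ⊗ h ⊗ T    ≈⟨ ⊗-assoc _ _ _ ⟩
          δ p ⊗ (h ⊗ T)  ≈⟨ *-congˡ (⊗-comm h T) ⟩
          δ p ⊗ (T ⊗ h)  ≈⟨ ⊗-assoc _ _ _ ⟨
          δ p ⊗ T ⊗ h    ≈⟨ *-congʳ (multiple ε≈0) ⟨
          p ⊗ h          ≈⟨ e ⟩
          T ⊗ T ^ n      ≈⟨ ⊗-comm _ _ ⟩
          T ^ n ⊗ T      ∎))
        λ { (a , m , f) → k (a , suc m , (begin
          p                      ≈⟨ multiple ε≈0 ⟩
          δ p ⊗ T                ≈⟨ *-congʳ f ⟩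
          scal a ⊗ T ^ m ⊗ T     ≈⟨ ⊗-assoc _ _ _ ⟩
          scal a ⊗ (T ^ m ⊗ T)   ≈⟨ *-congˡ (⊗-comm _ _) ⟩
          scal a ⊗ T ^ suc m     ∎)) }
      (no ε≉0) → factor-of-T^ n (T-cancelʳ (begin
          p ⊗ δ h ⊗ T    ≈⟨ ⊗-assoc _ _ _ ⟩
          p ⊗ (δ h ⊗ T)  ≈⟨ *-congˡ (multiple (K-domain (K.trans (ε-cong e) (K.zeroˡ _)) ε≉0)) ⟨
          p ⊗ h          ≈⟨ e ⟩
          T ⊗ T ^ n      ≈⟨ ⊗-comm _ _ ⟩
          T ^ n ⊗ T      ∎)) k
    where
    multiple : ∀ {p} → ε p K.≈ K.0# → p ≈ δ p ⊗ T
    multiple {p} f = trans (expand p) (trans (+-congʳ (trans (scal-cong f) scal-0)) (⊕-idˡ _))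

  open Evaluation.At K ⊤ (λ _ → K.1#) using () renaming (eval to at1; eval-cong to at1-cong)

  at1-T^ : ∀ n → at1 (T ^ n) K.≈ K.1#
  at1-T^ zero    = K.refl
  at1-T^ (suc n) = K.trans (K.*-identityˡ _) (at1-T^ n)

  private
    cancel-+ : ∀ {a b} → a K.+ b K.≈ K.1# K.+ b → a K.≈ K.1#
    cancel-+ {a} {b} = +-cancelʳ b a K.1#
      where open import Algebra.Properties.Ring K.ring using (+-cancelʳ)

  -- The second hypothesis is p - 1 = (T - 1) q without subtraction. Evaluated at T = 1, it forces
  -- the scalar found by `factor-of-T^` to be 1.
  factor-of-T^≡1mod[T-1] : ∀ n {p h q} → p ⊗ h ≈ T ^ n → p ⊕ q ≈ one ⊕ T ⊗ q →
                           ¬ ¬ (Σ ℕ λ k → p ≈ T ^ k)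
  factor-of-T^≡1mod[T-1] n {p} {h} {q} e f k = factor-of-T^ n e λ { (a , m , g) →
    k (m , trans g (trans (*-congʳ (trans (scal-cong (K.trans
      (K.sym (K.trans (at1-cong g) (K.trans (K.*-congˡ (at1-T^ m)) (K.*-identityʳ a)))) p[1]≈1))
      scal-1)) (⊗-idˡ _))) }
    where
    p[1]≈1 : at1 p K.≈ K.1#
    p[1]≈1 = cancel-+ (K.trans (at1-cong f) (K.+-congˡ (K.*-identityˡ _)))

  T^-factor-≤ : ∀ m n {h} → T ^ m ⊗ h ≈ T ^ n → m ≤ n
  T^-factor-≤ zero    n       e = z≤n
  T^-factor-≤ (suc m) zero    e = ⊥-elim (K.1≉0 (K.sym (K.trans
    (K.sym (K.trans (K.*-congʳ (K.zeroˡ _)) (K.zeroˡ _))) (ε-cong e))))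
  T^-factor-≤ (suc m) (suc n) {h} e = s≤s (T^-factor-≤ m n (T-cancelʳ (begin
    T ^ m ⊗ h ⊗ T    ≈⟨ ⊗-comm _ _ ⟩
    T ⊗ (T ^ m ⊗ h)  ≈⟨ ⊗-assoc _ _ _ ⟨
    T ^ suc m ⊗ h    ≈⟨ e ⟩
    T ⊗ T ^ n        ≈⟨ ⊗-comm _ _ ⟩
    T ^ n ⊗ T        ∎)))

-- Pairwise coprime moduli and the coding of finite sets

module Geometric {r s : Level} (R : Semiring r s) where
  open Semiring R
  open import Algebra.Properties.Semiring.Exp R
  open SetoidReasoning setoid

  geom : Carrier → ℕ → Carrier
  geom y zero    = 0#
  geom y (suc n) = 1# + y * geom y n

  -- (y − 1) geom y n = y ^ n − 1, without subtraction.
  geom-sum : ∀ y n → y ^ n + geom y n ≈ 1# + y * geom y n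
  geom-sum y zero    = +-congˡ (sym (zeroʳ y))
  geom-sum y (suc n) = begin
    y * y ^ n + (1# + y * geom y n)   ≈⟨ +-assoc _ _ _ ⟨
    (y * y ^ n + 1#) + y * geom y n   ≈⟨ +-congʳ (+-comm _ _) ⟩
    (1# + y * y ^ n) + y * geom y n   ≈⟨ +-assoc _ _ _ ⟩
    1# + (y * y ^ n + y * geom y n)   ≈⟨ +-congˡ (distribˡ _ _ _) ⟨
    1# + y * (y ^ n + geom y n)       ≈⟨ +-congˡ (*-congˡ (geom-sum y n)) ⟩
    1# + y * (1# + y * geom y n)      ∎

module UnitsModulo {r s : Level} (R : CommutativeRing r s) (e : CommutativeRing.Carrier R) where
  open CommutativeRing R
  open import Algebra.Properties.Ring ring using (-‿distribˡ-*; -‿distribʳ-*; -‿involutive)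
  open import Algebra.Properties.CommutativeSemigroup *-commutativeSemigroup using (interchange)
  open import Algebra.Properties.CommutativeSemiring.Exp commutativeSemiring
  open SetoidReasoning setoid

  -- Invertibility in the quotient of R by e, with explicit witnesses instead of a quotient ring.
  UnitMod : Carrier → Set (r ⊔ s)
  UnitMod a = Σ Carrier λ a′ → Σ Carrier λ q → a * a′ ≈ 1# + e * q

  UnitMod-resp : ∀ {a b} → a ≈ b → UnitMod a → UnitMod b
  UnitMod-resp f (a′ , q , g) = a′ , q , trans (*-congʳ (sym f)) g

  UnitMod-1 : UnitMod 1#
  UnitMod-1 = 1# , 0# , trans (*-identityˡ _) (sym (trans (+-congˡ (zeroʳ e)) (+-identityʳ _)))

  UnitMod-factorˡ : ∀ {a b} → UnitMod (a * b) → UnitMod a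
  UnitMod-factorˡ {a} {b} (c , q , g) = b * c , q , trans (sym (*-assoc _ _ _)) g

  UnitMod-factorʳ : ∀ {a b} → UnitMod (a * b) → UnitMod b
  UnitMod-factorʳ u = UnitMod-factorˡ (UnitMod-resp (*-comm _ _) u)

  UnitMod-* : ∀ {a b} → UnitMod a → UnitMod b → UnitMod (a * b)
  UnitMod-* {a} {b} (a′ , q , f) (b′ , t , g) = a′ * b′ , t + q * (1# + e * t) , (begin
    a * b * (a′ * b′)                    ≈⟨ interchange _ _ _ _ ⟩
    a * a′ * (b * b′)                    ≈⟨ *-cong f g ⟩
    (1# + e * q) * (1# + e * t)          ≈⟨ distribʳ _ _ _ ⟩
    1# * (1# + e * t) + e * q * (1# + e * t)  ≈⟨ +-cong (*-identityˡ _) (*-assoc _ _ _) ⟩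
    1# + e * t + e * (q * (1# + e * t))  ≈⟨ +-assoc _ _ _ ⟩
    1# + (e * t + e * (q * (1# + e * t)))  ≈⟨ +-congˡ (distribˡ _ _ _) ⟨
    1# + e * (t + q * (1# + e * t))      ∎)

  UnitMod-^ : ∀ {a} n → UnitMod a → UnitMod (a ^ n)
  UnitMod-^ zero    u = UnitMod-1
  UnitMod-^ (suc n) u = UnitMod-* u (UnitMod-^ n u)

  UnitMod-neg : ∀ {a} → UnitMod a → UnitMod (- a)
  UnitMod-neg {a} (a′ , q , g) = - a′ , q , (begin
    - a * - a′     ≈⟨ -‿distribˡ-* _ _ ⟨
    - (a * - a′)   ≈⟨ -‿cong (-‿distribʳ-* _ _) ⟨
    - (- (a * a′)) ≈⟨ -‿involutive _ ⟩
    a * a′         ≈⟨ g ⟩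
    1# + e * q     ∎)

  UnitMod-shift : ∀ {a} → UnitMod a → UnitMod (a + e)
  UnitMod-shift {a} (a′ , q , g) = a′ , q + a′ , (begin
    (a + e) * a′             ≈⟨ distribʳ _ _ _ ⟩
    a * a′ + e * a′          ≈⟨ +-congʳ g ⟩
    1# + e * q + e * a′      ≈⟨ +-assoc _ _ _ ⟩
    1# + (e * q + e * a′)    ≈⟨ +-congˡ (distribˡ _ _ _) ⟨
    1# + e * (q + a′)        ∎)

  -- Since e is 0 modulo itself, it is invertible there only if it is a unit: e a = 1 + e q gives
  -- the inverse a - q.
  modulus-unit : UnitMod e → Σ Carrier λ q → e * q ≈ 1#
  modulus-unit (a , q , g) = a + - q , (begin
    e * (a + - q)             ≈⟨ distribˡ _ _ _ ⟩
    e * a + e * - q           ≈⟨ +-cong g (sym (-‿distribʳ-* _ _)) ⟩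
    1# + e * q + - (e * q)    ≈⟨ +-assoc _ _ _ ⟩
    1# + (e * q + - (e * q))  ≈⟨ +-congˡ (-‿inverseʳ _) ⟩
    1# + 0#                   ≈⟨ +-identityʳ _ ⟩
    1#                        ∎)

-- The analogue of Gödel's β-function moduli: modulus n = 1 + T ^ n (T (T ^ L − 1)).
module Moduli {r s : Level} (R : CommutativeRing r s) (T : CommutativeRing.Carrier R) (L : ℕ) where
  open CommutativeRing R
  open import Algebra.Properties.Ring ring using (-‿distribˡ-*; +-cancelʳ)
  open import Algebra.Properties.CommutativeSemiring.Exp commutativeSemiring
  open Geometric semiring
  open SetoidReasoning setoid

  -- The factor T makes T a unit modulo every `modulus n`, also for n = 0; the factor T ^ L - 1 does
  -- the same for each T ^ d - 1 with d dividing L.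
  step : Carrier
  step = T * (T ^ L + - 1#)

  modulus : ℕ → Carrier
  modulus n = 1# + T ^ n * step

  private
    geom-product : ∀ y n → (y + - 1#) * geom y n ≈ y ^ n + - 1#
    geom-product y n = +-cancelʳ (geom y n) _ _ (begin
      (y + - 1#) * geom y n + geom y n               ≈⟨ +-congʳ (distribʳ _ _ _) ⟩
      y * geom y n + - 1# * geom y n + geom y n      ≈⟨ +-congʳ (+-congˡ
                                                          (trans (sym (-‿distribˡ-* _ _)) (-‿cong (*-identityˡ _)))) ⟩
      y * geom y n + - geom y n + geom y n           ≈⟨ +-assoc _ _ _ ⟩
      y * geom y n + (- geom y n + geom y n)         ≈⟨ +-congˡ (-‿inverseˡ _) ⟩
      y * geom y n + 0#                              ≈⟨ +-congˡ (-‿inverseˡ _) ⟨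
      y * geom y n + (- 1# + 1#)                     ≈⟨ +-congˡ (+-comm _ _) ⟩
      y * geom y n + (1# + - 1#)                     ≈⟨ +-assoc _ _ _ ⟨
      y * geom y n + 1# + - 1#                       ≈⟨ +-congʳ (+-comm _ _) ⟩
      1# + y * geom y n + - 1#                       ≈⟨ +-congʳ (geom-sum y n) ⟨
      y ^ n + geom y n + - 1#                        ≈⟨ +-assoc _ _ _ ⟩
      y ^ n + (geom y n + - 1#)                      ≈⟨ +-congˡ (+-comm _ _) ⟩
      y ^ n + (- 1# + geom y n)                      ≈⟨ +-assoc _ _ _ ⟨
      y ^ n + - 1# + geom y n                        ∎)

    -- modulus (n + d) − modulus n, with modulus n moved to the left
    difference : ∀ n d → (T ^ d + - 1#) * (T ^ n * step) + modulus n ≈ modulus (n ℕ.+ d)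
    difference n d = begin
      (T ^ d + - 1#) * (T ^ n * step) + (1# + T ^ n * step)
        ≈⟨ +-cong (distribʳ _ _ _) (+-comm _ _) ⟩
      T ^ d * (T ^ n * step) + - 1# * (T ^ n * step) + (T ^ n * step + 1#)
        ≈⟨ +-assoc _ _ _ ⟩
      T ^ d * (T ^ n * step) + (- 1# * (T ^ n * step) + (T ^ n * step + 1#))
        ≈⟨ +-congˡ (+-assoc _ _ _) ⟨
      T ^ d * (T ^ n * step) + (- 1# * (T ^ n * step) + T ^ n * step + 1#)
        ≈⟨ +-congˡ (+-congʳ (+-congʳ (trans (sym (-‿distribˡ-* _ _)) (-‿cong (*-identityˡ _))))) ⟩
      T ^ d * (T ^ n * step) + (- (T ^ n * step) + T ^ n * step + 1#)
        ≈⟨ +-congˡ (trans (+-congʳ (-‿inverseˡ _)) (+-identityˡ _)) ⟩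
      T ^ d * (T ^ n * step) + 1#
        ≈⟨ +-comm _ _ ⟩
      1# + T ^ d * (T ^ n * step)
        ≈⟨ +-congˡ (*-assoc _ _ _) ⟨
      1# + T ^ d * T ^ n * step
        ≈⟨ +-congˡ (*-congʳ (trans (*-comm _ _) (sym (^-homo-* T n d)))) ⟩
      modulus (n ℕ.+ d) ∎

  module Mod (n : ℕ) where
    open UnitsModulo R (modulus n) public

    -- This product is -1 modulo `modulus n`; hence all its factors are units there.
    unit-T^*step : UnitMod (T ^ n * step)
    unit-T^*step = - 1# , - 1# , (begin
      T ^ n * step * - 1#                        ≈⟨ +-identityˡ _ ⟨
      0# + T ^ n * step * - 1#                   ≈⟨ +-congʳ (-‿inverseʳ _) ⟨
      1# + - 1# + T ^ n * step * - 1#            ≈⟨ +-assoc _ _ _ ⟩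
      1# + (- 1# + T ^ n * step * - 1#)          ≈⟨ +-congˡ (+-congʳ (*-identityˡ _)) ⟨
      1# + (1# * - 1# + T ^ n * step * - 1#)     ≈⟨ +-congˡ (distribʳ _ _ _) ⟨
      1# + modulus n * - 1#                      ∎)

    unit-step : UnitMod step
    unit-step = UnitMod-factorʳ unit-T^*step

    unit-T : UnitMod T
    unit-T = UnitMod-factorˡ unit-step

    -- By the geometric sum, T ^ d - 1 divides T ^ L - 1, which is a factor of `step`.
    unit-T^-1 : ∀ {d} → d ∣ L → UnitMod (T ^ d + - 1#)
    unit-T^-1 {d} (divides q eq) = UnitMod-factorˡ (UnitMod-resp (sym (trans (geom-product (T ^ d) q)
      (+-congʳ (trans (^-assocʳ T d q) (^-congʳ T (≡.trans (ℕ.*-comm d q) (≡.sym eq)))))))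
      (UnitMod-factorʳ unit-step))

    unit-difference : ∀ m {d} → d ∣ L → UnitMod ((T ^ d + - 1#) * (T ^ m * step))
    unit-difference m d∣L = UnitMod-* (unit-T^-1 d∣L) (UnitMod-* (UnitMod-^ m unit-T) unit-step)

    -- The two moduli differ by (T ^ d - 1) T ^ n `step`, a product of units modulo the
    -- smaller-indexed one.
    coprime-above : ∀ d → d ∣ L → UnitMod (modulus (n ℕ.+ d))
    coprime-above d d∣L = UnitMod-resp (difference n d) (UnitMod-shift (unit-difference n d∣L))

  -- The same difference, now read modulo the larger-indexed modulus and with the opposite sign.
  coprime-below : ∀ m d → d ∣ L → Mod.UnitMod (m ℕ.+ d) (modulus m)
  coprime-below m d d∣L = UnitMod-resp (begin
      - D + modulus (m ℕ.+ d)  ≈⟨ +-congˡ (difference m d) ⟨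
      - D + (D + modulus m)    ≈⟨ +-assoc _ _ _ ⟨
      - D + D + modulus m      ≈⟨ +-congʳ (-‿inverseˡ _) ⟩
      0# + modulus m           ≈⟨ +-identityˡ _ ⟩
      modulus m                ∎)
    (UnitMod-shift (UnitMod-neg (unit-difference m d∣L)))
    where
    open Mod (m ℕ.+ d)
    D : Carrier
    D = (T ^ d + - 1#) * (T ^ m * step)

  product : List ℕ → Carrier
  product []       = 1#
  product (m ∷ ms) = modulus m * product ms

  product-divisible : ∀ {n ms} → n ∈ ms → Σ Carrier λ q → modulus n * q ≈ product ms
  product-divisible {ms = m ∷ ms} (here ≡.refl) = product ms , refl
  product-divisible {n} {m ∷ ms} (there i) with product-divisible i
  ... | q , f = modulus m * q , trans (sym (*-assoc _ _ _)) (trans (*-congʳ (*-comm _ _))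
    (trans (*-assoc _ _ _) (*-congˡ f)))

  module _ {N : ℕ} (divisible : ∀ {d} → 1 ≤ d → d ≤ N → d ∣ L) where
    -- The distance of m and n lies between 1 and N, hence divides L.
    coprime : ∀ {m n} → m ≤ N → n ≤ N → ¬ m ≡ n → Mod.UnitMod n (modulus m)
    coprime {m} {n} m≤N n≤N m≢n with ℕ.<-cmp m n
    ... | tri< m<n _ _ = ≡.subst (λ n → Mod.UnitMod n (modulus m)) (ℕ.m+[n∸m]≡n (ℕ.<⇒≤ m<n))
      (coprime-below m (n ℕ.∸ m) (divisible (ℕ.m<n⇒0<n∸m m<n) (ℕ.≤-trans (ℕ.m∸n≤m n m) n≤N)))
    ... | tri≈ _ m≡n _ = ⊥-elim (m≢n m≡n)
    ... | tri> _ _ n<m = ≡.subst (λ m → Mod.UnitMod n (modulus m)) (ℕ.m+[n∸m]≡n (ℕ.<⇒≤ n<m))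
      (Mod.coprime-above n (m ℕ.∸ n) (divisible (ℕ.m<n⇒0<n∸m n<m) (ℕ.≤-trans (ℕ.m∸n≤m m n) m≤N)))

    coprime-product : ∀ {n} ms → n ≤ N → (∀ {m} → m ∈ ms → m ≤ N) → ¬ n ∈ ms →
                      Mod.UnitMod n (product ms)
    coprime-product {n} []       n≤N ms≤N n∉ = Mod.UnitMod-1 n
    coprime-product {n} (m ∷ ms) n≤N ms≤N n∉ = Mod.UnitMod-* n
      (coprime (ms≤N (here ≡.refl)) n≤N (λ m≡n → n∉ (here (≡.sym m≡n))))
      (coprime-product ms n≤N (λ i → ms≤N (there i)) (λ i → n∉ (there i)))

-- The reason for choosing L = N !: every distance between distinct exponents up to N divides it.
≤⇒∣! : ∀ {d n} → 1 ≤ d → d ≤ n → d ∣ n !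
≤⇒∣! {suc d} 1≤d d≤n = ∣-trans (m∣m*n (d !)) (m≤n⇒m!∣n! d≤n)

module SetCoding {c ℓ : Level} (K : Field c ℓ) (N : ℕ) where
  open OneVariable K
  private module K = Field K
  open Ring (FreeAlgebraRing.ring K ⊤) using (*-congˡ; *-congʳ)
  open Moduli commutativeRing T (N !) public using (step; modulus; product; product-divisible)
  open Moduli commutativeRing T (N !) using (module Mod)
  private module M = Moduli commutativeRing T (N !)

  Top-T^ : ∀ n → Top n (T ^ n) K.1#
  Top-T^ zero    = sym scal-1
  Top-T^ (suc n) = Top-cast {suc n} {p = T ^ suc n} (K.*-identityˡ _)
    (Top-⊗ 1 {n} {T} {T ^ n} (sym scal-1) (Top-T^ n))

  Top-T^-1 : ∀ n → 1 ≤ n → Top n (T ^ n ⊕ neg one) K.1#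
  Top-T^-1 (suc n) _ = Top-cast {suc n} {p = T ^ suc n ⊕ neg one} (K.+-identityʳ _)
    (Top-⊕ {suc n} {p = T ^ suc n} {q = neg one} (Top-T^ (suc n))
    (trans (δ^-cong n (trans (+-inverseˡ-unique _ _ (neg-invˡ _)) -0#≈0#)) (trans (δ^-zer n) (sym scal-0))))
    where open import Algebra.Properties.Ring (FreeAlgebraRing.ring K ⊤) using (+-inverseˡ-unique; -0#≈0#)

  -- The coefficient in the positive degree n + 1 + N ! is 1, in every characteristic; as N ! is at
  -- least 1, the summand -1 in `step` does not reach this degree.
  modulus-nonconstant : ∀ n a → ¬ modulus n ≈ scal a
  modulus-nonconstant n a e = K.1≉0 (scal-injective (trans (sym top) (Top-resp {k} (sym e) const)))
    where
    k : ℕ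
    k = n ℕ.+ suc (N !)
    k≡ : k ≡ suc (n ℕ.+ N !)
    k≡ = ℕ.+-suc n (N !)
    const : Top k (scal a) K.0#
    const rewrite k≡ = trans (δ^-zer (n ℕ.+ N !)) (sym scal-0)
    const1 : Top k one K.0#
    const1 rewrite k≡ = Top-one (n ℕ.+ N !)
    top : Top k (modulus n) K.1#
    top = Top-cast {k} {p = modulus n} (K.trans (K.+-identityˡ _) (K.trans (K.*-identityˡ _) (K.*-identityˡ _)))
      (Top-⊕ {k} {p = one} {q = T ^ n ⊗ step} const1
        (Top-⊗ n {p = T ^ n} {q = step} (Top-T^ n)
        (Top-⊗ 1 {n = N !} {p = T} {q = T ^ (N !) ⊕ neg one} (sym scal-1)
        (Top-T^-1 (N !) (ℕ.1≤n! N)))))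

  -- If n were missing, the product would be a unit modulo `modulus n`, and so would its divisor
  -- `modulus n`. Then `modulus n` would be a unit of the polynomial ring, hence constant.
  divides-product⇒∈ : ∀ {n q} ms → n ≤ N → (∀ {m} → m ∈ ms → m ≤ N) →
                      modulus n ⊗ q ≈ product ms → n ∈ ms
  divides-product⇒∈ {n} ms n≤N ms≤N e with n ∈? ms
  ... | yes n∈ms = n∈ms
  ... | no n∉ms  = ⊥-elim (unit-constant (proj₂ (Mod.modulus-unit n (Mod.UnitMod-factorˡ n
    (Mod.UnitMod-resp n (sym e) (M.coprime-product ≤⇒∣! ms n≤N ms≤N n∉ms)))))
    λ { (a , f) → modulus-nonconstant n a f })

-- Separating sets of powers of x

Affine : Set
Affine = ℕ × ℕ

_$ₐ_ : Affine → ℕ → ℕ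
(a , b) $ₐ k = a ℕ.* k ℕ.+ b

Rule : Set
Rule = Affine × Affine

pow : ∀ {m} → ℕ → Fin m → Term m
pow zero    i = `1
pow (suc n) i = var i `· pow n i

-- For t = x ^ k this is x ^ (α $ₐ k).
monomial : ∀ {m} → Affine → (t x : Fin m) → Term m
monomial (a , b) t x = pow a t `· pow b x

-- t commutes with x and is 1 modulo x - 1, the latter without subtraction. All powers of x satisfy
-- this; for a generator x the converse is used only for divisors of a power of x, a condition that
-- `memF` supplies.
powerF : ∀ {m} (t x : Fin m) → Formula m
powerF t x = ((var t `· var x) `≡ (var x `· var t)) `∧
  `∃ ((var (Fin.suc t) `+ var Fin.zero) `≡ (`1 `+ (var (Fin.suc x) `· var Fin.zero)))

-- For the intended b = x ^ N, the first conjunct bounds the exponent; the second says that the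
-- modulus belonging to the monomial divides w.
memF : ∀ {m} → Affine → (t x b v w : Fin m) → Formula m
memF α t x b v w =
  `∃ ((monomial α (Fin.suc t) (Fin.suc x) `· var Fin.zero) `≡ var (Fin.suc b)) `∧
  `∃ (((`1 `+ (monomial α (Fin.suc t) (Fin.suc x) `· var (Fin.suc v))) `· var Fin.zero)
        `≡ var (Fin.suc w))

¬F_ : ∀ {m} → Formula m → Formula m
¬F φ = φ `⇒ `⊥

-- The free variables are, from the innermost on, w, v, b, z, x.
ruleF : Rule → Formula 5
ruleF (α , β) = `∀ (powerF (# 0) (# 5) `⇒ (memF α (# 0) (# 5) (# 3) (# 2) (# 1) `⇒
  -- Double negation, because the exponent of t is found only under one.
  (¬F (¬F memF β (# 0) (# 5) (# 3) (# 2) (# 1)))))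

rulesF : List Rule → Formula 5
rulesF []       = `0 `≡ `0
rulesF (r ∷ rs) = ruleF r `∧ rulesF rs

rejectF : Affine → Formula 5
rejectF α = `∀ (powerF (# 0) (# 5) `⇒ (¬F memF α (# 0) (# 5) (# 3) (# 2) (# 1)))

-- The variable z stands for x ^ (2 ^ n), where n is the input, so z ^ M has as exponent the code M
-- 2 ^ n of the initial state.
separatorF : ℕ → List Rule → Affine → Formula 2
separatorF M rules accept = `∃ (`∃ (`∃
  (memF (M , 0) (# 3) (# 4) (# 2) (# 1) (# 0) `∧ (rulesF rules `∧ rejectF accept))))

-- The term x ^ (2 ^ n), where x is the variable 1.
squaring : ℕ → Term 2
squaring zero    = var (# 1)
squaring (suc n) = squaring n `· squaring n

-- The number enters through an equation for the variable 0 and θ itself is left untouched, so the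
-- code of the result is a simple function of n and the code of θ.
substitute : Formula 2 → ℕ → Sentence
substitute θ n = `∃ (`∃ ((var (# 0) `≡ squaring n) `∧ θ))

-- Truth of the separator formula in the free algebra

module SeparatorSemantics {c ℓ x : Level} (K : Field c ℓ) (X : Set x) where
  open FreeAlgebra K X
  open Semantics (𝔸-structure K X)
  open Ring (FreeAlgebraRing.ring K X) using (setoid; semiring; *-congˡ; *-congʳ; +-congˡ)
  open import Algebra.Properties.Semiring.Exp semiring
  open Geometric semiring
  open SetoidReasoning setoid

  IsPower : Poly → Poly → Set (c ⊔ ℓ ⊔ x)
  IsPower y t = t ⊗ y ≈ y ⊗ t × Σ Poly λ q → t ⊕ q ≈ one ⊕ y ⊗ q

  Member : (b v w s : Poly) → Set (c ⊔ ℓ ⊔ x)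
  Member b v w s = (Σ Poly λ u → s ⊗ u ≈ b) × (Σ Poly λ q → (one ⊕ s ⊗ v) ⊗ q ≈ w)

  monomialₚ : Affine → Poly → Poly → Poly
  monomialₚ (a , b) t y = t ^ a ⊗ y ^ b

  Member-resp : ∀ {b v w s s′} → s ≈ s′ → Member b v w s → Member b v w s′
  Member-resp e ((u , f) , (q , g)) =
    (u , trans (*-congʳ (sym e)) f) , (q , trans (*-congʳ (+-congˡ (*-congʳ (sym e)))) g)

  ^-IsPower : ∀ y k → IsPower y (y ^ k)
  ^-IsPower y k = commutes k , geom y k , geom-sum y k
    where
    commutes : ∀ k → y ^ k ⊗ y ≈ y ⊗ y ^ k
    commutes zero    = trans (⊗-idˡ _) (sym (⊗-idʳ _))
    commutes (suc k) = trans (⊗-assoc _ _ _) (*-congˡ (commutes k))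

  monomial-power : ∀ α y k → monomialₚ α (y ^ k) y ≈ y ^ (α $ₐ k)
  monomial-power (a , b) y k = trans (*-congʳ (trans (^-assocʳ y k a)
    (^-congʳ y (ℕ.*-comm k a)))) (sym (^-homo-* y (a ℕ.* k) b))

  ⟦pow⟧ : ∀ {m} n (i : Fin m) ρ → ⟦ pow n i ⟧ₜ ρ ≡ ρ i ^ n
  ⟦pow⟧ zero    i ρ = ≡.refl
  ⟦pow⟧ (suc n) i ρ = ≡.cong (ρ i ⊗_) (⟦pow⟧ n i ρ)

  ⟦monomial⟧ : ∀ {m} α (t y : Fin m) ρ → ⟦ monomial α t y ⟧ₜ ρ ≡ monomialₚ α (ρ t) (ρ y)
  ⟦monomial⟧ (a , b) t y ρ = ≡.cong₂ _⊗_ (⟦pow⟧ a t ρ) (⟦pow⟧ b y ρ)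

  ⟦squaring⟧ : ∀ n ρ → ⟦ squaring n ⟧ₜ ρ ≈ ρ (# 1) ^ (2 ℕ.^ n)
  ⟦squaring⟧ zero    ρ = sym (⊗-idʳ _)
  ⟦squaring⟧ (suc n) ρ = trans (⊗-cong (⟦squaring⟧ n ρ) (⟦squaring⟧ n ρ))
    (trans (sym (^-homo-* _ (2 ℕ.^ n) (2 ℕ.^ n)))
      (^-congʳ (ρ (# 1)) (≡.cong (2 ℕ.^ n ℕ.+_) (≡.sym (ℕ.+-identityʳ _)))))

  module _ {m} (ρ : Env m) where
    powerF⁺ : ∀ t y → IsPower (ρ y) (ρ t) → ρ ⊨ powerF t y
    powerF⁺ t y (e , q , f) = lift e , q , lift f

    powerF⁻ : ∀ t y → ρ ⊨ powerF t y → IsPower (ρ y) (ρ t)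
    powerF⁻ t y (lift e , q , lift f) = e , q , f

    memF⁺ : ∀ α t y b v w → Member (ρ b) (ρ v) (ρ w) (monomialₚ α (ρ t) (ρ y)) →
            ρ ⊨ memF α t y b v w
    memF⁺ α t y b v w ((u , e) , (q , f)) =
      (u , lift (≡.subst (λ s → s ⊗ u ≈ ρ b) (≡.sym (⟦monomial⟧ α _ _ (extend u ρ))) e)) ,
      (q , lift (≡.subst (λ s → (one ⊕ s ⊗ ρ v) ⊗ q ≈ ρ w) (≡.sym (⟦monomial⟧ α _ _ (extend q ρ))) f))

    memF⁻ : ∀ α t y b v w → ρ ⊨ memF α t y b v w →
            Member (ρ b) (ρ v) (ρ w) (monomialₚ α (ρ t) (ρ y))
    memF⁻ α t y b v w ((u , lift e) , (q , lift f)) =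
      (u , ≡.subst (λ s → s ⊗ u ≈ ρ b) (⟦monomial⟧ α _ _ (extend u ρ)) e) ,
      (q , ≡.subst (λ s → (one ⊕ s ⊗ ρ v) ⊗ q ≈ ρ w) (⟦monomial⟧ α _ _ (extend q ρ)) f)

  record Separator (init : ℕ) (rules : List Rule) (accept : Affine) : Set (Level.suc (c ⊔ ℓ ⊔ x)) where
    field
      Holds    : ℕ → Set (c ⊔ ℓ ⊔ x)
      initial  : Holds init
      closed   : ∀ {α β} → (α , β) ∈ rules → ∀ k → Holds (α $ₐ k) → Holds (β $ₐ k)
      disjoint : ∀ k → ¬ Holds (accept $ₐ k)

  -- The witness y may be any element: its powers satisfy `powerF`, so the rules can be instantiated
  -- at t = y ^ k.
  separatorF-sound : ∀ M rules accept n → Th (substitute (separatorF M rules accept) n) →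
    Separator (M ℕ.* 2 ℕ.^ n) rules accept
  separatorF-sound M rules accept n (y , z , lift z≈ , b , v , w , init , rs , rej) = record
    -- The double negation matches the conclusions of the rules, and disjointness is a negative
    -- statement anyway.
    { Holds    = λ n → ¬ ¬ Member b v w (y ^ n)
    ; initial  = λ k → k (Member-resp (begin
        z ^ M ⊗ one                ≈⟨ ⊗-idʳ _ ⟩
        z ^ M                      ≈⟨ ^-congˡ M (trans z≈ (⟦squaring⟧ n (extend z (extend y emptyEnv)))) ⟩
        (y ^ (2 ℕ.^ n)) ^ M        ≈⟨ ^-assocʳ y (2 ℕ.^ n) M ⟩
        y ^ (2 ℕ.^ n ℕ.* M)        ≡⟨ ≡.cong (y ^_) (ℕ.*-comm (2 ℕ.^ n) M) ⟩
        y ^ (M ℕ.* 2 ℕ.^ n)        ∎) (memF⁻ ρ (M , 0) (# 3) (# 4) (# 2) (# 1) (# 0) init))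
    ; closed   = λ r∈ k h h′ → h λ mem → closed rules rs r∈ k mem h′
    ; disjoint = λ k h → h λ mem → lower (rej (y ^ k) (powerF⁺ (ρₜ k) (# 0) (# 5) (^-IsPower y k))
        (memF⁺ (ρₜ k) accept (# 0) (# 5) (# 3) (# 2) (# 1) (Member-resp (sym (monomial-power accept y k)) mem)))
    }
    where
    ρ : Env 5
    ρ = extend w (extend v (extend b (extend z (extend y emptyEnv))))
    ρₜ : ℕ → Env 6
    ρₜ k = extend (y ^ k) ρ
    closed : ∀ rules → ρ ⊨ rulesF rules → ∀ {α β} → (α , β) ∈ rules → ∀ k →
             Member b v w (y ^ (α $ₐ k)) → ¬ ¬ Member b v w (y ^ (β $ₐ k))
    closed (r ∷ rs) (f , fs) (there i) k mem h = closed rs fs i k mem h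
    closed ((α , β) ∷ rs) (f , fs) (here ≡.refl) k mem h = lower (f (y ^ k)
      (powerF⁺ (ρₜ k) (# 0) (# 5) (^-IsPower y k))
      (memF⁺ (ρₜ k) α (# 0) (# 5) (# 3) (# 2) (# 1) (Member-resp (sym (monomial-power α y k)) mem))
      λ mem′ → lift (h (Member-resp (monomial-power β y k) (memF⁻ (ρₜ k) β (# 0) (# 5) (# 3) (# 2) (# 1) mem′))))

  module Complete (y : X) where
    private
      module B  = OneVariable K
      module BR = Ring (FreeAlgebraRing.ring K ⊤)
    open Rename.Along K X ⊤ (λ _ → tt) using () renaming (eval to φ; eval-cong to φ-cong)
    open Rename.Along K ⊤ X (λ _ → y) using () renaming (eval to ι; eval-cong to ι-cong)
    open Derivation K X using (ε; δ; δ^; degree; scal-0; Univariate; Univariate-δ;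
      centralizer-Univariate)

    φ∘ι : ∀ p → φ (ι p) ≡ p
    φ∘ι (B.scal a)  = ≡.refl
    φ∘ι (B.gen tt)  = ≡.refl
    φ∘ι B.zer       = ≡.refl
    φ∘ι B.one       = ≡.refl
    φ∘ι (p B.⊕ q)   = ≡.cong₂ B._⊕_ (φ∘ι p) (φ∘ι q)
    φ∘ι (p B.⊗ q)   = ≡.cong₂ B._⊗_ (φ∘ι p) (φ∘ι q)
    φ∘ι (B.neg p)   = ≡.cong B.neg (φ∘ι p)

    ι-^ : ∀ p n → ι (p B.^ n) ≡ ι p ^ n
    ι-^ p zero    = ≡.refl
    ι-^ p (suc n) = ≡.cong (ι p ⊗_) (ι-^ p n)

    φ-^ : ∀ p n → φ (p ^ n) ≡ φ p B.^ n
    φ-^ p zero    = ≡.refl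
    φ-^ p (suc n) = ≡.cong (φ p B.⊗_) (φ-^ p n)

    -- Identifying all generators loses nothing on polynomials in y: the constant term is split off
    -- by `Univariate`, and `δ p` is annihilated by one application of `δ` fewer.
    Univariate⇒ι∘φ : ∀ p → Univariate y p → p ≈ ι (φ p)
    Univariate⇒ι∘φ p u = descend (proj₁ (degree p)) u (trans (proj₂ (degree p)) scal-0)
      where
      descend : ∀ n {p} → Univariate y p → δ^ n p ≈ zer → p ≈ ι (φ p)
      descend zero    u e = trans e (sym (ι-cong (φ-cong e)))
      descend (suc n) {p} u e = begin
        p                                    ≈⟨ u ⟩
        scal (ε p) ⊕ δ p ⊗ gen y             ≈⟨ +-congˡ (*-congʳ (descend n (Univariate-δ u) e)) ⟩
        ι (φ (scal (ε p) ⊕ δ p ⊗ gen y))     ≈⟨ ι-cong (φ-cong u) ⟨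
        ι (φ p)                              ∎

    module _ (F : List ℕ) (N : ℕ) (bounded : ∀ {n} → n ∈ F → n ≤ N) where
      open SetCoding K N
      private
        b v w : Poly
        b = ι (B.T B.^ N)
        v = ι step
        w = ι (product F)

      member⁺ : ∀ {n} → n ∈ F → Member b v w (gen y ^ n)
      member⁺ {n} i = (gen y ^ (N ℕ.∸ n) , (begin
          gen y ^ n ⊗ gen y ^ (N ℕ.∸ n)  ≈⟨ ^-homo-* (gen y) n (N ℕ.∸ n) ⟨
          gen y ^ (n ℕ.+ (N ℕ.∸ n))      ≡⟨ ≡.cong (gen y ^_) (ℕ.m+[n∸m]≡n (bounded i)) ⟩
          gen y ^ N                      ≡⟨ ι-^ B.T N ⟨
          b                              ∎)) ,
        (ι (proj₁ div) , (begin
          (one ⊕ gen y ^ n ⊗ v) ⊗ ι (proj₁ div)  ≡⟨ ≡.cong (λ s → (one ⊕ s ⊗ v) ⊗ ι (proj₁ div)) (ι-^ B.T n) ⟨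
          ι (modulus n B.⊗ proj₁ div)            ≈⟨ ι-cong (proj₂ div) ⟩
          w                                      ∎))
        where
        div : Σ B.Poly λ q → modulus n B.⊗ q B.≈ product F
        div = product-divisible i

      -- The equations are mapped to one variable. As t occurs with positive exponent, its image
      -- divides T ^ N and is 1 modulo T - 1, so it is some T ^ j; since t commutes with the
      -- generator, t itself is the j-th power. Divisibility of the product then puts the exponent
      -- of the monomial into F.
      member⁻ : ∀ a d {t} → IsPower (gen y) t → Member b v w (monomialₚ (suc a , d) t (gen y)) →
                ¬ ¬ (Σ ℕ λ k → t ≈ gen y ^ k × (suc a , d) $ₐ k ∈ F)
      member⁻ a d {t} (comm , q , f) ((u , g) , (r , h)) k =
        B.factor-of-T^≡1mod[T-1] N
          (B.trans (B.sym (B.trans (BR.*-congʳ (B.⊗-assoc _ _ _)) (B.⊗-assoc _ _ _))) dividesT)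
          (φ-cong f) λ { (j , e) → k (j , t≈ j e , in-F j e) }
        where
        dividesT : φ t B.^ suc a B.⊗ B.T B.^ d B.⊗ φ u B.≈ B.T B.^ N
        dividesT = ≡.subst₂ B._≈_
          (≡.cong₂ (λ p q → p B.⊗ q B.⊗ φ u) (φ-^ t (suc a)) (φ-^ (gen y) d))
          (φ∘ι _) (φ-cong g)
        dividesW : (B.one B.⊕ φ t B.^ suc a B.⊗ B.T B.^ d B.⊗ step) B.⊗ φ r B.≈ product F
        dividesW = ≡.subst₂ B._≈_
          (≡.cong₂ (λ s st → (B.one B.⊕ s B.⊗ st) B.⊗ φ r)
            (≡.cong₂ B._⊗_ (φ-^ t (suc a)) (φ-^ (gen y) d)) (φ∘ι step))
          (φ∘ι _) (φ-cong h)
        t≈ : ∀ j → φ t B.≈ B.T B.^ j → t ≈ gen y ^ j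
        t≈ j e = trans (Univariate⇒ι∘φ t (centralizer-Univariate comm))
          (≡.subst (ι (φ t) ≈_) (ι-^ B.T j) (ι-cong e))
        exponent : ∀ j → φ t B.≈ B.T B.^ j →
                   φ t B.^ suc a B.⊗ B.T B.^ d B.≈ B.T B.^ ((suc a , d) $ₐ j)
        exponent j e = B.trans (BR.*-congʳ (B.trans (B.^-congˡ (suc a) e)
          (B.trans (B.^-assocʳ B.T j (suc a)) (B.^-congʳ B.T (ℕ.*-comm j (suc a))))))
          (B.sym (B.^-homo-* B.T (suc a ℕ.* j) d))
        in-F : ∀ j → φ t B.≈ B.T B.^ j → (suc a , d) $ₐ j ∈ F
        in-F j e = divides-product⇒∈ F
          (B.T^-factor-≤ _ N (B.trans (BR.*-congʳ (B.sym (exponent j e))) dividesT)) bounded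
          (B.trans (BR.*-congʳ (BR.+-congˡ (BR.*-congʳ (B.sym (exponent j e))))) dividesW)

      separatorF-complete′ : ∀ M rules accept n →
        M ℕ.* 2 ℕ.^ n ∈ F →
        (∀ {α β} → (α , β) ∈ rules → 1 ≤ proj₁ α × (∀ k → α $ₐ k ∈ F → β $ₐ k ∈ F)) →
        1 ≤ proj₁ accept → (∀ k → ¬ accept $ₐ k ∈ F) →
        Th (substitute (separatorF M rules accept) n)
      separatorF-complete′ M rules accept n init∈F closed 1≤accept disjoint =
        gen y , z , lift (sym (⟦squaring⟧ n (extend z ρ₁))) , b , v , w ,
        memF⁺ ρ (M , 0) (# 3) (# 4) (# 2) (# 1) (# 0) (Member-resp (sym z^M) (member⁺ init∈F)) ,
        rulesF⁺ rules closed ,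
        rejectF⁺ accept 1≤accept disjoint
        where
        ρ₁ : Env 1
        ρ₁ = extend (gen y) emptyEnv
        z : Poly
        z = gen y ^ (2 ℕ.^ n)
        ρ : Env 5
        ρ = extend w (extend v (extend b (extend z ρ₁)))
        z^M : z ^ M ⊗ one ≈ gen y ^ (M ℕ.* 2 ℕ.^ n)
        z^M = begin
          z ^ M ⊗ one                    ≈⟨ ⊗-idʳ _ ⟩
          z ^ M                          ≈⟨ ^-assocʳ (gen y) (2 ℕ.^ n) M ⟩
          gen y ^ (2 ℕ.^ n ℕ.* M)        ≡⟨ ≡.cong (gen y ^_) (ℕ.*-comm (2 ℕ.^ n) M) ⟩
          gen y ^ (M ℕ.* 2 ℕ.^ n)        ∎
        rulesF⁺ : ∀ rules →
          (∀ {α β} → (α , β) ∈ rules → 1 ≤ proj₁ α × (∀ k → α $ₐ k ∈ F → β $ₐ k ∈ F)) →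
          ρ ⊨ rulesF rules
        rulesF⁺ [] closed = lift refl
        rulesF⁺ (((zero , d) , β) ∷ rs) closed = ⊥-elim (ℕ.1+n≰n (proj₁ (closed (here ≡.refl))))
        rulesF⁺ (((suc a , d) , β) ∷ rs) closed =
          (λ t power mem ¬mem → lift (member⁻ a d (powerF⁻ (extend t ρ) (# 0) (# 5) power)
            (memF⁻ (extend t ρ) (suc a , d) (# 0) (# 5) (# 3) (# 2) (# 1) mem) λ { (k , t≈ , i) →
              lower (¬mem (memF⁺ (extend t ρ) β (# 0) (# 5) (# 3) (# 2) (# 1) (Member-resp
                (trans (sym (monomial-power β (gen y) k)) (*-congʳ (^-congˡ (proj₁ β) (sym t≈))))
                (member⁺ (proj₂ (closed (here ≡.refl)) k i))))) })) ,
          rulesF⁺ rs (λ i → closed (there i))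
        rejectF⁺ : ∀ α → 1 ≤ proj₁ α → (∀ k → ¬ α $ₐ k ∈ F) → ρ ⊨ rejectF α
        rejectF⁺ (suc a , d) 1≤ disjoint = λ t power mem → lift (member⁻ a d
          (powerF⁻ (extend t ρ) (# 0) (# 5) power)
          (memF⁻ (extend t ρ) (suc a , d) (# 0) (# 5) (# 3) (# 2) (# 1) mem)
          λ { (k , _ , i) → disjoint k i })

    separatorF-complete : ∀ F M rules accept n →
      M ℕ.* 2 ℕ.^ n ∈ F →
      (∀ {α β} → (α , β) ∈ rules → 1 ≤ proj₁ α × (∀ k → α $ₐ k ∈ F → β $ₐ k ∈ F)) →
      1 ≤ proj₁ accept → (∀ k → ¬ accept $ₐ k ∈ F) →
      Th (substitute (separatorF M rules accept) n)
    separatorF-complete F = separatorF-complete′ F (max 0 F) (λ i → lookup (xs≤max 0 F) i)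

-- Register machines

open import Data.Nat using (_+_; _*_; _^_; _%_; _/_; _⊓_)

-- Pointwise, since registers are functions; read from R′ to R it is a decrement.
Increment : ℕ → Registers → Registers → Set
Increment r R R′ = R′ r ≡ suc (R r) × (∀ s → ¬ s ≡ r → R′ s ≡ R s)

-- The final address is exactly `length Q`, so every address of a halting computation is at most
-- `length Q` and can be a remainder modulo `suc (length Q)`. The derivation itself is the finite
-- computation from which the trace is read.
data Halts (Q : Program) (o : ℕ) (pc : ℕ) (R : Registers) : Set where
  halted   : pc ≡ length Q → R 0 ≡ o → Halts Q o pc R
  inc-step : ∀ {r j R′} → fetch Q pc ≡ just (inc r j) → Increment r R R′ →
             Halts Q o j R′ → Halts Q o pc R
  dec-zero : ∀ {r j l} → fetch Q pc ≡ just (dec r j l) → R r ≡ 0 →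
             Halts Q o j R → Halts Q o pc R
  dec-suc  : ∀ {r j l R′} → fetch Q pc ≡ just (dec r j l) → Increment r R′ R →
             Halts Q o l R′ → Halts Q o pc R

fetch-++ˡ : ∀ P Q {i ins} → fetch P i ≡ just ins → fetch (P ++ Q) i ≡ just ins
fetch-++ˡ (_ ∷ P) Q {zero}  e = e
fetch-++ˡ (_ ∷ P) Q {suc i} e = fetch-++ˡ P Q e

fetch-++ʳ : ∀ P Q i → fetch (P ++ Q) (length P + i) ≡ fetch Q i
fetch-++ʳ []      Q i = ≡.refl
fetch-++ʳ (_ ∷ P) Q i = fetch-++ʳ P Q i

fetch-length : ∀ Q → fetch Q (length Q) ≡ nothing
fetch-length []      = ≡.refl
fetch-length (_ ∷ Q) = fetch-length Q

fetch-just⇒< : ∀ Q {i ins} → fetch Q i ≡ just ins → i < length Q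
fetch-just⇒< (_ ∷ Q) {zero}  e = s≤s z≤n
fetch-just⇒< (_ ∷ Q) {suc i} e = s≤s (fetch-just⇒< Q e)

fetch-nothing⇒≥ : ∀ Q {i} → fetch Q i ≡ nothing → length Q ≤ i
fetch-nothing⇒≥ []      e = z≤n
fetch-nothing⇒≥ (_ ∷ Q) {suc i} e = s≤s (fetch-nothing⇒≥ Q e)

⟨_⟩ : List ℕ → Registers
⟨ [] ⟩     _       = 0
⟨ x ∷ xs ⟩ zero    = x
⟨ x ∷ xs ⟩ (suc r) = ⟨ xs ⟩ r

assign : List ℕ → ℕ → ℕ → List ℕ
assign []       zero    v = v ∷ []
assign []       (suc r) v = 0 ∷ assign [] r v
assign (x ∷ xs) zero    v = v ∷ xs
assign (x ∷ xs) (suc r) v = x ∷ assign xs r v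

assign-same : ∀ xs r v → ⟨ assign xs r v ⟩ r ≡ v
assign-same []       zero    v = ≡.refl
assign-same []       (suc r) v = assign-same [] r v
assign-same (x ∷ xs) zero    v = ≡.refl
assign-same (x ∷ xs) (suc r) v = assign-same xs r v

assign-other : ∀ xs r v s → ¬ s ≡ r → ⟨ assign xs r v ⟩ s ≡ ⟨ xs ⟩ s
assign-other []       zero    v zero    s≢r = ⊥-elim (s≢r ≡.refl)
assign-other []       zero    v (suc s) s≢r = ≡.refl
assign-other []       (suc r) v zero    s≢r = ≡.refl
assign-other []       (suc r) v (suc s) s≢r = assign-other [] r v s (λ e → s≢r (≡.cong suc e))
assign-other (x ∷ xs) zero    v zero    s≢r = ⊥-elim (s≢r ≡.refl)
assign-other (x ∷ xs) zero    v (suc s) s≢r = ≡.refl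
assign-other (x ∷ xs) (suc r) v zero    s≢r = ≡.refl
assign-other (x ∷ xs) (suc r) v (suc s) s≢r = assign-other xs r v s (λ e → s≢r (≡.cong suc e))

-- A structured language compiled to register machines

data Cmd : Set where
  incr clear : ℕ → Cmd
  _⨾_  : Cmd → Cmd → Cmd
  loop : ℕ → Cmd → Cmd

infixr 5 _⨾_

infix 4 _⊢_⇓_
data _⊢_⇓_ : Cmd → List ℕ → List ℕ → Set where
  incr⇓  : ∀ {r xs} → incr r ⊢ xs ⇓ assign xs r (suc (⟨ xs ⟩ r))
  done⇓  : ∀ {r xs} → ⟨ xs ⟩ r ≡ 0 → clear r ⊢ xs ⇓ xs
  clear⇓ : ∀ {r xs ys v} → ⟨ xs ⟩ r ≡ suc v → clear r ⊢ assign xs r v ⇓ ys → clear r ⊢ xs ⇓ ys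
  _⨾⇓_   : ∀ {c d xs ys zs} → c ⊢ xs ⇓ ys → d ⊢ ys ⇓ zs → c ⨾ d ⊢ xs ⇓ zs
  stop⇓  : ∀ {r c xs} → ⟨ xs ⟩ r ≡ 0 → loop r c ⊢ xs ⇓ xs
  loop⇓  : ∀ {r c xs ys zs v} → ⟨ xs ⟩ r ≡ suc v → c ⊢ assign xs r v ⇓ ys →
           loop r c ⊢ ys ⇓ zs → loop r c ⊢ xs ⇓ zs

infixr 5 _⨾⇓_

size : Cmd → ℕ
size (incr r)   = 1
size (clear r)  = 1
size (c ⨾ d)    = size c + size d
size (loop r c) = suc (size c)

-- Jumps are absolute: the code is laid out from `start` on, and its exit is `next`. A loop takes a
-- single `dec`, which tests and decrements before each pass.
compile : Cmd → (start next : ℕ) → Program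
compile (incr r)   start next = inc r next ∷ []
compile (clear r)  start next = dec r next start ∷ []
compile (c ⨾ d)    start next =
  compile c start (start + size c) ++ compile d (start + size c) next
compile (loop r c) start next = dec r next (suc start) ∷ compile c (suc start) start

length-compile : ∀ c start next → length (compile c start next) ≡ size c
length-compile (incr r)   start next = ≡.refl
length-compile (clear r)  start next = ≡.refl
length-compile (c ⨾ d)    start next = ≡.trans (length-++ (compile c start (start + size c)))
  (≡.cong₂ _+_ (length-compile c _ _) (length-compile d _ _))
length-compile (loop r c) start next = ≡.cong suc (length-compile c _ _)

module _ {Q : Program} {o : ℕ} where
  Located : ℕ → Program → Set
  Located start code = ∀ {i ins} → fetch code i ≡ just ins → fetch Q (start + i) ≡ just ins

  private
    head-located : ∀ {start ins code} → Located start (ins ∷ code) → fetch Q start ≡ just ins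
    head-located {start} {ins} loc =
      ≡.subst (λ a → fetch Q a ≡ just ins) (ℕ.+-identityʳ start) (loc {zero} ≡.refl)

    tail-located : ∀ {start ins code} → Located start (ins ∷ code) → Located (suc start) code
    tail-located {start} loc {i} {ins} e =
      ≡.subst (λ a → fetch Q a ≡ just ins) (ℕ.+-suc start i) (loc {suc i} e)

    right-located : ∀ {start} code code′ → Located start (code ++ code′) →
                    Located (start + length code) code′
    right-located {start} code code′ loc {i} {ins} e =
      ≡.subst (λ a → fetch Q a ≡ just ins) (≡.sym (ℕ.+-assoc start (length code) i))
        (loc {length code + i} (≡.trans (fetch-++ʳ code code′ i) e))

    decrement : ∀ xs {r v} → ⟨ xs ⟩ r ≡ suc v → Increment r ⟨ assign xs r v ⟩ ⟨ xs ⟩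
    decrement xs {r} {v} e = ≡.trans e (≡.cong suc (≡.sym (assign-same xs r v))) ,
      λ s s≢r → ≡.sym (assign-other xs r v s s≢r)

  -- In continuation form: a halting computation from `next` is extended backwards along the
  -- evaluation, without counting steps.
  compile-correct : ∀ {c xs ys} → c ⊢ xs ⇓ ys → ∀ {start next} →
    Located start (compile c start next) → Halts Q o next ⟨ ys ⟩ → Halts Q o start ⟨ xs ⟩
  compile-correct (incr⇓ {r} {xs}) loc h =
    inc-step (head-located loc) (assign-same xs r _ , assign-other xs r _) h
  compile-correct (done⇓ e) loc h = dec-zero (head-located loc) e h
  compile-correct (clear⇓ {r} {xs} {v = v} e p) loc h =
    dec-suc (head-located loc) (decrement xs e) (compile-correct p loc h)
  compile-correct {c ⨾ d} (p ⨾⇓ q) {start} {next} loc h =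
    compile-correct p (λ e → loc (fetch-++ˡ (compile c start (start + size c)) _ e))
      (compile-correct q (≡.subst (λ n → Located (start + n) (compile d (start + size c) next))
        (length-compile c start (start + size c))
        (right-located (compile c start (start + size c)) _ loc)) h)
  compile-correct (stop⇓ e) loc h = dec-zero (head-located loc) e h
  compile-correct (loop⇓ {r} {xs = xs} {v = v} e p q) loc h =
    dec-suc (head-located loc)
      (decrement xs e)
      (compile-correct p (tail-located loc) (compile-correct q loc h))

-- Addresses beyond the end of P, where P halts, are all sent to length P.
relocate : ℕ → Program → ℕ → ℕ
relocate start P j = start + (j ⊓ length P)

relocateInstr : ℕ → Program → Instr → Instr
relocateInstr start P (inc r j)   = inc r (relocate start P j)
relocateInstr start P (dec r j l) = dec r (relocate start P j) (relocate start P l)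

infixr 5 _then_
_then_ : Cmd → Program → Program
c then P = compile c 0 (size c) ++ map (relocateInstr (size c) P) P

length-then : ∀ c P → length (c then P) ≡ size c + length P
length-then c P = ≡.trans (length-++ (compile c 0 (size c)))
  (≡.cong₂ _+_ (length-compile c 0 _) (length-map _ P))

fetch-map : ∀ f P {i ins} → fetch P i ≡ just ins → fetch (map f P) i ≡ just (f ins)
fetch-map f (_ ∷ P) {zero}  ≡.refl = ≡.refl
fetch-map f (_ ∷ P) {suc i} e      = fetch-map f P e

update-same : ∀ R r v → update R r v r ≡ v
update-same R r v with r ℕ.≟ r
... | yes _  = ≡.refl
... | no r≢r = ⊥-elim (r≢r ≡.refl)

update-other : ∀ R r v s → ¬ s ≡ r → update R r v s ≡ R s
update-other R r v s s≢r with s ℕ.≟ r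
... | yes s≡r = ⊥-elim (s≢r s≡r)
... | no _    = ≡.refl

Increment-resp : ∀ {r R R′ S S′} → (∀ s → S s ≡ R s) → (∀ s → S′ s ≡ R′ s) →
                 Increment r R R′ → Increment r S S′
Increment-resp {r} e f (p , q) = ≡.trans (f r) (≡.trans p (≡.cong suc (≡.sym (e r)))) ,
  λ s s≢r → ≡.trans (f s) (≡.trans (q s s≢r) (≡.sym (e s)))

Halts-resp : ∀ {Q o pc R S} → (∀ s → S s ≡ R s) → Halts Q o pc R → Halts Q o pc S
Halts-resp e (halted f g)     = halted f (≡.trans (e 0) g)
Halts-resp e (inc-step f i h) = inc-step f (Increment-resp e (λ _ → ≡.refl) i) h
Halts-resp e (dec-zero f z h) = dec-zero f (≡.trans (e _) z) (Halts-resp e h)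
Halts-resp e (dec-suc f i h)  = dec-suc f (Increment-resp (λ _ → ≡.refl) e i) h

module _ (c : Cmd) (P : Program) where
  private
    fetch-relocated : ∀ {pc ins} → fetch P pc ≡ just ins →
      fetch (c then P) (relocate (size c) P pc) ≡ just (relocateInstr (size c) P ins)
    fetch-relocated {pc} {ins} e = ≡.subst
      (λ a → fetch (c then P) a ≡ just (relocateInstr (size c) P ins)) address
      (≡.trans (fetch-++ʳ (compile c 0 (size c)) _ pc) (fetch-map _ P e))
      where
      address : length (compile c 0 (size c)) + pc ≡ relocate (size c) P pc
      address = ≡.cong₂ _+_ (length-compile c 0 _) (≡.sym (ℕ.m≤n⇒m⊓n≡m (ℕ.<⇒≤ (fetch-just⇒< P e))))

  runFrom-halts : ∀ k {pc R o} → runFrom P k pc R ≡ just o →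
                  Halts (c then P) o (relocate (size c) P pc) R
  runFrom-halts k {pc} {R} e with fetch P pc in eq
  runFrom-halts k {pc} {R} ≡.refl | nothing = halted (≡.trans (≡.cong (size c +_)
    (ℕ.m≥n⇒m⊓n≡n (fetch-nothing⇒≥ P eq))) (≡.sym (length-then c P))) ≡.refl
  runFrom-halts (suc k) {pc} {R} e | just (inc r j) =
    inc-step (fetch-relocated eq) (update-same R r _ , update-other R r _) (runFrom-halts k e)
  runFrom-halts (suc k) {pc} {R} e | just (dec r j l) with R r in eq′
  ... | zero  = dec-zero (fetch-relocated eq) eq′ (runFrom-halts k e)
  ... | suc v = dec-suc (fetch-relocated eq)
    (≡.trans eq′ (≡.cong suc (≡.sym (update-same R r v))) , λ s s≢r → ≡.sym (update-other R r v s s≢r))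
    (runFrom-halts k e)

  then-halts : ∀ {k m o ys xs} → c ⊢ ys ⇓ xs → (∀ s → ⟨ xs ⟩ s ≡ ⟨ m ∷ [] ⟩ s) →
               run P k m ≡ just o → Halts (c then P) o 0 ⟨ ys ⟩
  then-halts {k} p e r = compile-correct p (fetch-++ˡ (compile c 0 (size c)) _)
    (≡.subst (λ a → Halts (c then P) _ a _) (ℕ.+-identityʳ (size c))
      (Halts-resp (λ { zero → e 0 ; (suc s) → e (suc s) }) (runFrom-halts k r)))

-- Applying a formula to its own number, as a register program

private
  variable
    a b c d e f g : ℕ

-- Register 0 holds the input and the output, 1 the code under construction, 2 a copy of the
-- input, 3 the first argument of pair; 4, 5 and 6 are scratch.
copy₁₃ move₄₁ copy₅₄ move₆₅ triangle₃ pair₃₁ : Cmd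
copy₁₃    = loop 1 (incr 3 ⨾ incr 4)
move₄₁    = loop 4 (incr 1)
copy₅₄    = loop 5 (incr 4 ⨾ incr 6)
move₆₅    = loop 6 (incr 5)
triangle₃ = loop 3 (incr 5 ⨾ copy₅₄ ⨾ move₆₅)
pair₃₁    = copy₁₃ ⨾ triangle₃ ⨾ clear 5 ⨾ move₄₁

copy₁₃⇓ : ∀ b → copy₁₃ ⊢ a ∷ b ∷ c ∷ d ∷ e ∷ f ∷ g ∷ [] ⇓ a ∷ 0 ∷ c ∷ b + d ∷ b + e ∷ f ∷ g ∷ []
copy₁₃⇓ zero = stop⇓ ≡.refl
copy₁₃⇓ {d = d} {e = e} (suc b) rewrite ≡.sym (ℕ.+-suc b d) | ≡.sym (ℕ.+-suc b e) =
  loop⇓ ≡.refl (incr⇓ ⨾⇓ incr⇓) (copy₁₃⇓ b)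

move₄₁⇓ : ∀ e → move₄₁ ⊢ a ∷ b ∷ c ∷ d ∷ e ∷ f ∷ g ∷ [] ⇓ a ∷ e + b ∷ c ∷ d ∷ 0 ∷ f ∷ g ∷ []
move₄₁⇓ zero = stop⇓ ≡.refl
move₄₁⇓ {b = b} (suc e) rewrite ≡.sym (ℕ.+-suc e b) = loop⇓ ≡.refl incr⇓ (move₄₁⇓ e)

copy₅₄⇓ : ∀ f → copy₅₄ ⊢ a ∷ b ∷ c ∷ d ∷ e ∷ f ∷ g ∷ [] ⇓ a ∷ b ∷ c ∷ d ∷ f + e ∷ 0 ∷ f + g ∷ []
copy₅₄⇓ zero = stop⇓ ≡.refl
copy₅₄⇓ {e = e} {g = g} (suc f) rewrite ≡.sym (ℕ.+-suc f e) | ≡.sym (ℕ.+-suc f g) =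
  loop⇓ ≡.refl (incr⇓ ⨾⇓ incr⇓) (copy₅₄⇓ f)

move₆₅⇓ : ∀ g → move₆₅ ⊢ a ∷ b ∷ c ∷ d ∷ e ∷ f ∷ g ∷ [] ⇓ a ∷ b ∷ c ∷ d ∷ e ∷ g + f ∷ 0 ∷ []
move₆₅⇓ zero = stop⇓ ≡.refl
move₆₅⇓ {f = f} (suc g) rewrite ≡.sym (ℕ.+-suc g f) = loop⇓ ≡.refl incr⇓ (move₆₅⇓ g)

clear₅⇓ : ∀ f → clear 5 ⊢ a ∷ b ∷ c ∷ d ∷ e ∷ f ∷ g ∷ [] ⇓ a ∷ b ∷ c ∷ d ∷ e ∷ 0 ∷ g ∷ []
clear₅⇓ zero    = done⇓ ≡.refl
clear₅⇓ (suc f) = clear⇓ ≡.refl (clear₅⇓ f)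

-- Loop invariant: register 5 counts the passes made so far, and register 4 exceeds its original
-- content e by `triangle f`.
triangle₃⇓ : ∀ d f → triangle₃ ⊢ a ∷ b ∷ c ∷ d ∷ triangle f + e ∷ f ∷ 0 ∷ []
                               ⇓ a ∷ b ∷ c ∷ 0 ∷ triangle (d + f) + e ∷ d + f ∷ 0 ∷ []
triangle₃⇓ zero f = stop⇓ ≡.refl
triangle₃⇓ {a} {b} {c} {e} (suc d) f =
  loop⇓ ≡.refl (incr⇓ ⨾⇓ copy₅₄⇓ (suc f) ⨾⇓ move₆₅⇓ (suc f + 0))
    (≡.subst₂ (λ u v → triangle₃ ⊢ a ∷ b ∷ c ∷ d ∷ u ∷ v ∷ 0 ∷ [] ⇓ result (suc d + f))
      (ℕ.+-assoc (suc f) (triangle f) e)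
      (≡.sym (≡.trans (ℕ.+-identityʳ _) (ℕ.+-identityʳ _)))
      (≡.subst (λ s → triangle₃ ⊢ a ∷ b ∷ c ∷ d ∷ triangle (suc f) + e ∷ suc f ∷ 0 ∷ [] ⇓ result s)
        (ℕ.+-suc d f) (triangle₃⇓ d (suc f))))
  where
  result : ℕ → List ℕ
  result s = a ∷ b ∷ c ∷ 0 ∷ triangle s + e ∷ s ∷ 0 ∷ []

-- `copy₁₃` leaves b + d in register 3 and b in register 4; adding the triangular number of the
-- former to the latter is Cantor's formula.
pair₃₁⇓ : ∀ d b → pair₃₁ ⊢ a ∷ b ∷ c ∷ d ∷ 0 ∷ 0 ∷ 0 ∷ [] ⇓ a ∷ pair d b ∷ c ∷ 0 ∷ 0 ∷ 0 ∷ 0 ∷ []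
pair₃₁⇓ {a} {c} d b = copy₁₃⇓ b ⨾⇓ triangle₃⇓ (b + d) 0 ⨾⇓ clear₅⇓ _ ⨾⇓
  ≡.subst (λ u → move₄₁ ⊢ a ∷ 0 ∷ c ∷ 0 ∷ triangle (b + d + 0) + (b + 0) ∷ 0 ∷ 0 ∷ []
                          ⇓ a ∷ u ∷ c ∷ 0 ∷ 0 ∷ 0 ∷ 0 ∷ [])
    (≡.trans (ℕ.+-identityʳ _) (≡.cong₂ (λ s n → triangle s + n)
      (≡.trans (ℕ.+-identityʳ _) (ℕ.+-comm b d)) (ℕ.+-identityʳ b)))
    (move₄₁⇓ (triangle (b + d + 0) + (b + 0)))

pair[_,r₁] : ℕ → Cmd
pair[ zero  ,r₁] = pair₃₁
pair[ suc d ,r₁] = incr 3 ⨾ pair[ d ,r₁]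

pair[,r₁]⇓ : ∀ k {d b} → pair[ k ,r₁] ⊢ a ∷ b ∷ c ∷ d ∷ 0 ∷ 0 ∷ 0 ∷ []
                                ⇓ a ∷ pair (k + d) b ∷ c ∷ 0 ∷ 0 ∷ 0 ∷ 0 ∷ []
pair[,r₁]⇓ zero        = pair₃₁⇓ _ _
pair[,r₁]⇓ {a} {c} (suc k) {d} {b} = incr⇓ ⨾⇓
  ≡.subst (λ s → pair[ k ,r₁] ⊢ a ∷ b ∷ c ∷ suc d ∷ 0 ∷ 0 ∷ 0 ∷ [] ⇓ a ∷ pair s b ∷ c ∷ 0 ∷ 0 ∷ 0 ∷ 0 ∷ [])
    (ℕ.+-suc k d) (pair[,r₁]⇓ k)

-- On codes of terms, the product of a term with itself; 4 is the tag of products.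
square : ℕ → ℕ
square t = pair 4 (pair t t)

square₁ : Cmd
square₁ = copy₁₃ ⨾ move₄₁ ⨾ pair₃₁ ⨾ pair[ 4 ,r₁]

square₁⇓ : ∀ b → square₁ ⊢ a ∷ b ∷ c ∷ 0 ∷ 0 ∷ 0 ∷ 0 ∷ [] ⇓ a ∷ square b ∷ c ∷ 0 ∷ 0 ∷ 0 ∷ 0 ∷ []
square₁⇓ {a} {c} b =
  ≡.subst₂ (λ u v → copy₁₃ ⊢ a ∷ b ∷ c ∷ 0 ∷ 0 ∷ 0 ∷ 0 ∷ [] ⇓ a ∷ 0 ∷ c ∷ u ∷ v ∷ 0 ∷ 0 ∷ [])
    (ℕ.+-identityʳ b) (ℕ.+-identityʳ b) (copy₁₃⇓ b) ⨾⇓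
  ≡.subst (λ u → move₄₁ ⊢ a ∷ 0 ∷ c ∷ b ∷ b ∷ 0 ∷ 0 ∷ [] ⇓ a ∷ u ∷ c ∷ b ∷ 0 ∷ 0 ∷ 0 ∷ [])
    (ℕ.+-identityʳ b) (move₄₁⇓ b) ⨾⇓
  pair₃₁⇓ b b ⨾⇓ pair[,r₁]⇓ 4

-- The accumulator form follows the loop of `squares₁`; `squares-comm` relates it to the recursion
-- of `squaring`.
squares : ℕ → ℕ → ℕ
squares zero    t = t
squares (suc n) t = squares n (square t)

squares-comm : ∀ n t → squares n (square t) ≡ square (squares n t)
squares-comm zero    t = ≡.refl
squares-comm (suc n) t = squares-comm n (square t)

squares₁ : Cmd
squares₁ = loop 0 (incr 2 ⨾ square₁)

squares₁⇓ : ∀ a {b c} → squares₁ ⊢ a ∷ b ∷ c ∷ 0 ∷ 0 ∷ 0 ∷ 0 ∷ []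
                       ⇓ 0 ∷ squares a b ∷ a + c ∷ 0 ∷ 0 ∷ 0 ∷ 0 ∷ []
squares₁⇓ zero            = stop⇓ ≡.refl
squares₁⇓ (suc a) {b} {c} rewrite ≡.sym (ℕ.+-suc a c) =
  loop⇓ ≡.refl (incr⇓ ⨾⇓ square₁⇓ b) (squares₁⇓ a)

move₁₃ move₂₁ move₁₀ : Cmd
move₁₃ = loop 1 (incr 3)
move₂₁ = loop 2 (incr 1)
move₁₀ = loop 1 (incr 0)

move₁₃⇓ : ∀ b → move₁₃ ⊢ a ∷ b ∷ c ∷ d ∷ e ∷ f ∷ g ∷ [] ⇓ a ∷ 0 ∷ c ∷ b + d ∷ e ∷ f ∷ g ∷ []
move₁₃⇓ zero = stop⇓ ≡.refl
move₁₃⇓ {d = d} (suc b) rewrite ≡.sym (ℕ.+-suc b d) = loop⇓ ≡.refl incr⇓ (move₁₃⇓ b)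

move₂₁⇓ : ∀ c → move₂₁ ⊢ a ∷ b ∷ c ∷ d ∷ e ∷ f ∷ g ∷ [] ⇓ a ∷ c + b ∷ 0 ∷ d ∷ e ∷ f ∷ g ∷ []
move₂₁⇓ zero = stop⇓ ≡.refl
move₂₁⇓ {b = b} (suc c) rewrite ≡.sym (ℕ.+-suc c b) = loop⇓ ≡.refl incr⇓ (move₂₁⇓ c)

move₁₀⇓ : ∀ b → move₁₀ ⊢ a ∷ b ∷ c ∷ d ∷ e ∷ f ∷ g ∷ [] ⇓ b + a ∷ 0 ∷ c ∷ d ∷ e ∷ f ∷ g ∷ []
move₁₀⇓ zero = stop⇓ ≡.refl
move₁₀⇓ {a = a} (suc b) rewrite ≡.sym (ℕ.+-suc b a) = loop⇓ ≡.refl incr⇓ (move₁₀⇓ b)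

substitution : Cmd
substitution = incr 1 ⨾ incr 1 ⨾ squares₁ ⨾ pair[ 0 ,r₁] ⨾ pair[ 0 ,r₁] ⨾ move₁₃ ⨾ move₂₁ ⨾
  pair[ 0 ,r₁] ⨾ pair[ 2 ,r₁] ⨾ pair[ 6 ,r₁] ⨾ pair[ 6 ,r₁] ⨾ move₁₀

-- The innermost 2 is `pair 0 1`, the code of the variable 1. Of the two zeros, the inner one is
-- `pair 0 0`, the code of the variable 0, and the outer one tags equations; the other 2 tags
-- conjunctions and 6 tags existential quantifiers.
diagonalNumber : ℕ → ℕ
diagonalNumber n = pair 6 (pair 6 (pair 2 (pair (pair 0 (pair 0 (squares n 2))) n)))

private
  squares-code : ∀ n → ⌜ squaring n ⌝ₜ ≡ squares n 2
  squares-code zero    = ≡.refl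
  squares-code (suc n) = ≡.trans (≡.cong square (squares-code n)) (≡.sym (squares-comm n 2))

substitute-code : ∀ θ → ⌜ substitute θ ⌜ θ ⌝ ⌝ ≡ diagonalNumber ⌜ θ ⌝
substitute-code θ = ≡.subst (λ s → ⌜ substitute θ ⌜ θ ⌝ ⌝ ≡
    pair 6 (pair 6 (pair 2 (pair (pair 0 (pair 0 s)) ⌜ θ ⌝))))
  (squares-code ⌜ θ ⌝) ≡.refl

substitution⇓ : ∀ n → substitution ⊢ n ∷ 0 ∷ 0 ∷ 0 ∷ 0 ∷ 0 ∷ 0 ∷ []
                                   ⇓ diagonalNumber n ∷ 0 ∷ 0 ∷ 0 ∷ 0 ∷ 0 ∷ 0 ∷ []
substitution⇓ n = incr⇓ ⨾⇓ incr⇓ ⨾⇓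
  ≡.subst (λ u → squares₁ ⊢ n ∷ 2 ∷ 0 ∷ 0 ∷ 0 ∷ 0 ∷ 0 ∷ []
                          ⇓ 0 ∷ squares n 2 ∷ u ∷ 0 ∷ 0 ∷ 0 ∷ 0 ∷ []) (ℕ.+-identityʳ n) (squares₁⇓ n) ⨾⇓
  pair[,r₁]⇓ 0 ⨾⇓ pair[,r₁]⇓ 0 ⨾⇓
  ≡.subst (λ u → move₁₃ ⊢ 0 ∷ t ∷ n ∷ 0 ∷ 0 ∷ 0 ∷ 0 ∷ [] ⇓ 0 ∷ 0 ∷ n ∷ u ∷ 0 ∷ 0 ∷ 0 ∷ [])
    (ℕ.+-identityʳ t) (move₁₃⇓ t) ⨾⇓
  ≡.subst (λ u → move₂₁ ⊢ 0 ∷ 0 ∷ n ∷ t ∷ 0 ∷ 0 ∷ 0 ∷ [] ⇓ 0 ∷ u ∷ 0 ∷ t ∷ 0 ∷ 0 ∷ 0 ∷ [])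
    (ℕ.+-identityʳ n) (move₂₁⇓ n) ⨾⇓
  pair₃₁⇓ t n ⨾⇓ pair[,r₁]⇓ 2 ⨾⇓ pair[,r₁]⇓ 6 ⨾⇓ pair[,r₁]⇓ 6 ⨾⇓
  ≡.subst (λ u → move₁₀ ⊢ 0 ∷ diagonalNumber n ∷ 0 ∷ 0 ∷ 0 ∷ 0 ∷ 0 ∷ [] ⇓ u ∷ 0 ∷ 0 ∷ 0 ∷ 0 ∷ 0 ∷ 0 ∷ [])
    (ℕ.+-identityʳ (diagonalNumber n)) (move₁₀⇓ (diagonalNumber n))
  where
  t : ℕ
  t = pair 0 (pair 0 (squares n 2))

-- Codes of machine states

-- predSylvester n is the product of the terms of Sylvester's sequence 2, 3, 7, 43, … before
-- sylvester n; any pairwise coprime sequence starting with 2 would do.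
predSylvester sylvester : ℕ → ℕ
predSylvester zero    = 1
predSylvester (suc n) = suc (predSylvester n) * predSylvester n
sylvester n = suc (predSylvester n)

1≤predSylvester : ∀ n → 1 ≤ predSylvester n
1≤predSylvester zero    = ℕ.≤-refl
1≤predSylvester (suc n) = ℕ.*-mono-≤ {1} {sylvester n} (s≤s z≤n) (1≤predSylvester n)

sylvester∣predSylvester : ∀ {i j} → i < j → sylvester i ∣ predSylvester j
sylvester∣predSylvester {i} {suc j} (s≤s i≤j) with ℕ.m≤n⇒m<n∨m≡n i≤j
... | inj₁ i<j    = ∣n⇒∣m*n (sylvester j) (sylvester∣predSylvester i<j)
... | inj₂ ≡.refl = m∣m*n (predSylvester j)

sylvester-coprime-< : ∀ {i j} → i < j → Coprime (sylvester i) (sylvester j)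
sylvester-coprime-< {i} {j} i<j {d} (d∣i , d∣j) = ∣1⇒≡1 (∣m+n∣m⇒∣n
  (≡.subst (d ∣_) (ℕ.+-comm 1 (predSylvester j)) d∣j)
  (∣-trans d∣i (sylvester∣predSylvester i<j)))

sylvester-coprime : ∀ {i j} → ¬ i ≡ j → Coprime (sylvester i) (sylvester j)
sylvester-coprime {i} {j} i≢j with ℕ.<-cmp i j
... | tri< i<j _ _ = sylvester-coprime-< i<j
... | tri≈ _ i≡j _ = ⊥-elim (i≢j i≡j)
... | tri> _ _ j<i = Coprimality.sym (sylvester-coprime-< j<i)

-- Gödel's product of powers for the registers below m, with pairwise coprime bases in place of the
-- primes.
encode : ℕ → Registers → ℕ
encode zero    R = 1
encode (suc m) R = sylvester m ^ R m * encode m R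

private
  encode-cong : ∀ m {R R′} → (∀ s → s < m → R′ s ≡ R s) → encode m R′ ≡ encode m R
  encode-cong zero    e = ≡.refl
  encode-cong (suc m) e = ≡.cong₂ (λ v n → sylvester m ^ v * n) (e m ℕ.≤-refl)
    (encode-cong m λ s s<m → e s (ℕ.m<n⇒m<1+n s<m))

encode-Increment : ∀ m {r} R R′ → r < m → Increment r R R′ → encode m R′ ≡ sylvester r * encode m R
encode-Increment (suc m) {r} R R′ r<1+m i@(p , q) with m ℕ.≟ r
... | yes ≡.refl rewrite p | encode-cong m {R} {R′} (λ s s<m → q s (ℕ.<⇒≢ s<m)) =
  ℕ.*-assoc (sylvester m) (sylvester m ^ R m) (encode m R)
... | no m≢r rewrite q m m≢r | encode-Increment m R R′ (ℕ.≤∧≢⇒< (ℕ.s≤s⁻¹ r<1+m) (λ e → m≢r (≡.sym e))) i =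
  swap (sylvester m ^ R m) (sylvester r) (encode m R)
  where
  swap : ∀ a b c → a * (b * c) ≡ b * (a * c)
  swap = solve-∀

-- The other bases are coprime to that of r, so their powers can be stripped off one by one until
-- only 1 is left.
sylvester∤encode : ∀ m r R → R r ≡ 0 → ¬ sylvester r ∣ encode m R
sylvester∤encode zero r R z d = ℕ.<⇒≢ (s≤s (1≤predSylvester r)) (≡.sym (∣1⇒≡1 d))
sylvester∤encode (suc m) r R z d with m ℕ.≟ r
... | yes ≡.refl rewrite z = sylvester∤encode m r R z (≡.subst (sylvester m ∣_) (ℕ.*-identityˡ _) d)
... | no m≢r = sylvester∤encode m r R z (strip (R m) d)
  where
  strip : ∀ e {k} → sylvester r ∣ sylvester m ^ e * k → sylvester r ∣ k
  strip zero    {k} d = ≡.subst (sylvester r ∣_) (ℕ.*-identityˡ k) d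
  strip (suc e) {k} d = strip e (coprime-divisor (sylvester-coprime (λ r≡m → m≢r (≡.sym r≡m)))
    (≡.subst (sylvester r ∣_) (ℕ.*-assoc (sylvester m) (sylvester m ^ e) k) d))

-- The base of register 0 is 2, which makes the code of the input the exponent produced by
-- `squaring`.
encode-input : ∀ m R → (∀ s → R (suc s) ≡ 0) → encode (suc m) R ≡ 2 ^ R 0
encode-input zero    R z = ℕ.*-identityʳ _
encode-input (suc m) R z rewrite z m = ≡.trans (ℕ.*-identityˡ _) (encode-input m R z)

register : Instr → ℕ
register (inc r _)   = r
register (dec r _ _) = r

bound : Program → ℕ
bound []       = 0
bound (i ∷ is) = suc (register i) ℕ.⊔ bound is

register<bound : ∀ Q {pc ins} → fetch Q pc ≡ just ins → register ins < bound Q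
register<bound (i ∷ Q) {zero}  ≡.refl = ℕ.m≤m⊔n (suc (register i)) (bound Q)
register<bound (i ∷ Q) {suc pc} e     = ℕ.≤-trans (register<bound Q e) (ℕ.m≤n⊔m (suc (register i)) (bound Q))

-- The state (pc , R) is coded by M n + pc, where n is the code of R.
instrRules : ℕ → ℕ → Instr → List Rule
instrRules M pc (inc r j)   = ((M , pc) , (M * sylvester r , j)) ∷ []
instrRules M pc (dec r j l) = ((M * sylvester r , pc) , (M , l)) ∷
  -- Register r is 0 exactly if its base does not divide the code: one rule for each nonzero
  -- remainder `suc i`, of which there are `predSylvester r`.
  map (λ i → (M * sylvester r , M * suc i + pc) , (M * sylvester r , M * suc i + j)) (upTo (predSylvester r))

rulesFrom : ℕ → ℕ → Program → List Rule
rulesFrom M pc []       = []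
rulesFrom M pc (i ∷ is) = instrRules M pc i ++ rulesFrom M (suc pc) is

∈-rulesFrom⁺ : ∀ {M ins ρ} Q pc i → fetch Q i ≡ just ins → ρ ∈ instrRules M (pc + i) ins →
               ρ ∈ rulesFrom M pc Q
∈-rulesFrom⁺ {M} {ρ = ρ} (x ∷ Q) pc zero    ≡.refl ρ∈ =
  ∈-++⁺ˡ (≡.subst (λ a → ρ ∈ instrRules M a x) (ℕ.+-identityʳ pc) ρ∈)
∈-rulesFrom⁺ {M} {ins} {ρ} (x ∷ Q) pc (suc i) e ρ∈ = ∈-++⁺ʳ (instrRules M pc x)
  (∈-rulesFrom⁺ Q (suc pc) i e (≡.subst (λ a → ρ ∈ instrRules M a ins) (ℕ.+-suc pc i) ρ∈))

∈-rulesFrom⁻ : ∀ {M ρ} Q pc → ρ ∈ rulesFrom M pc Q →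
               Σ ℕ λ i → Σ Instr λ ins → fetch Q i ≡ just ins × ρ ∈ instrRules M (pc + i) ins
∈-rulesFrom⁻ {M} {ρ} (x ∷ Q) pc ρ∈ with ∈-++⁻ (instrRules M pc x) ρ∈
... | inj₁ ρ∈x = 0 , x , ≡.refl , ≡.subst (λ a → ρ ∈ instrRules M a x) (≡.sym (ℕ.+-identityʳ pc)) ρ∈x
... | inj₂ ρ∈Q with ∈-rulesFrom⁻ Q (suc pc) ρ∈Q
... | i , ins , e , ρ∈ins = suc i , ins , e ,
  ≡.subst (λ a → ρ ∈ instrRules M a ins) (≡.sym (ℕ.+-suc pc i)) ρ∈ins

euclid-unique : ∀ {L} k n {p q} → p ≤ L → q ≤ L → suc L * k + p ≡ suc L * n + q → p ≡ q × k ≡ n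
euclid-unique {L} k n {p} {q} p≤ q≤ e = p≡q , ℕ.*-cancelˡ-≡ k n (suc L)
  (ℕ.+-cancelʳ-≡ p _ _ (≡.trans e (≡.cong (suc L * n +_) (≡.sym p≡q))))
  where
  remainder : ∀ k {p} → p ≤ L → (suc L * k + p) % suc L ≡ p
  remainder k {p} p≤ = ≡.trans (≡.cong (_% suc L) (≡.trans (ℕ.+-comm (suc L * k) p)
    (≡.cong (p +_) (ℕ.*-comm (suc L) k)))) (≡.trans ([m+kn]%n≡m%n p k (suc L)) (m<n⇒m%n≡m (s≤s p≤)))
  p≡q : p ≡ q
  p≡q = ≡.trans (≡.sym (remainder k p≤)) (≡.trans (≡.cong (_% suc L) e) (remainder n q≤))

-- Simulation of the machine by affine rules

module Simulation (Q : Program) where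
  L M m : ℕ
  L = length Q
  M = suc L
  -- The successor ensures that register 0, which holds input and output, is always coded.
  m = suc (bound Q)

  rules : List Rule
  rules = rulesFrom M 0 Q

  -- Halting in a state whose register 0 contains 1, so that the code of the registers is
  -- 2 (2 k + 1).
  accept : Affine
  accept = M * 4 , M * 2 + L

  code : ℕ → Registers → ℕ
  code pc R = M * encode m R + pc

  code-input : ∀ R → (∀ s → R (suc s) ≡ 0) → code 0 R ≡ M * 2 ^ R 0
  code-input R z = ≡.trans (ℕ.+-identityʳ _) (≡.cong (M *_) (encode-input (bound Q) R z))

  private
    <m : ∀ {pc ins} → fetch Q pc ≡ just ins → register ins < m
    <m e = ℕ.m<n⇒m<1+n (register<bound Q e)

    rule : ∀ {ins ρ pc} → fetch Q pc ≡ just ins → ρ ∈ instrRules M pc ins → ρ ∈ rules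
    rule {pc = pc} e ρ∈ = ∈-rulesFrom⁺ Q 0 pc e ρ∈

    nonzero-remainder : ∀ r n → ¬ sylvester r ∣ n →
      Σ ℕ λ i → Σ ℕ λ k → i < predSylvester r × n ≡ sylvester r * k + suc i
    nonzero-remainder r n ∤n with n % sylvester r in eq | m%n<n n (sylvester r)
    ... | zero  | _ = ⊥-elim (∤n (divides (n / sylvester r)
      (≡.trans (m≡m%n+[m/n]*n n (sylvester r)) (≡.cong (_+ n / sylvester r * sylvester r) eq))))
    ... | suc i | s≤s i< = i , n / sylvester r , i< , ≡.trans (m≡m%n+[m/n]*n n (sylvester r))
      (≡.trans (≡.cong₂ _+_ eq (ℕ.*-comm (n / sylvester r) _)) (ℕ.+-comm (suc i) _))

    rotate : ∀ M s k i p → M * s * k + (M * i + p) ≡ M * (s * k + i) + p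
    rotate = solve-∀

    regroup : ∀ M s k p → M * s * k + p ≡ M * (s * k) + p
    regroup = solve-∀

    accept-code : ∀ k → accept $ₐ k ≡ M * (2 * (2 * k + 1)) + L
    accept-code k = lemma M k L
      where
      lemma : ∀ M k L → M * 4 * k + (M * 2 + L) ≡ M * (2 * (2 * k + 1)) + L
      lemma = solve-∀

    decrement : ∀ R {v} → R 0 ≡ suc v → Increment 0 (update R 0 v) R
    decrement R {v} e = ≡.trans e (≡.cong suc (≡.sym (update-same R 0 v))) ,
      λ s s≢0 → ≡.sym (update-other R 0 v s s≢0)

  -- Every set of codes closed under the rules follows the computation.
  no-acceptance : ∀ {h} (Holds : ℕ → Set h) →
    (∀ {α β} → (α , β) ∈ rules → ∀ k → Holds (α $ₐ k) → Holds (β $ₐ k)) →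
    (∀ k → ¬ Holds (accept $ₐ k)) →
    ∀ {pc R} → Halts Q 1 pc R → ¬ Holds (code pc R)
  -- Clearing register 0 leaves an odd code 2 k + 1; its content 1 contributes one factor 2, so the
  -- state has an accepting code.
  no-acceptance Holds closed disjoint {pc} {R} (halted ≡.refl R0≡1)
    with nonzero-remainder 0 (encode m (update R 0 0)) (sylvester∤encode m 0 (update R 0 0) (update-same R 0 0))
  ... | zero , k , _ , e = λ holds → disjoint k (≡.subst Holds (≡.trans
    (≡.cong (λ n → M * n + L) (≡.trans
      (encode-Increment m (update R 0 0) R (s≤s z≤n) (decrement R R0≡1)) (≡.cong (2 *_) e)))
    (≡.sym (accept-code k))) holds)
  ... | suc i , k , s≤s () , e
  no-acceptance Holds closed disjoint {pc} {R} (inc-step {r} {j} {R′} f i h) holds =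
    no-acceptance Holds closed disjoint h (≡.subst Holds (≡.trans (regroup M (sylvester r) (encode m R) j)
        (≡.cong (λ n → M * n + j) (≡.sym (encode-Increment m R R′ (<m f) i))))
      (closed (rule f (here ≡.refl)) (encode m R) holds))
  no-acceptance Holds closed disjoint {pc} {R} (dec-zero {r} {j} {l} f z h) holds
    with nonzero-remainder r (encode m R) (sylvester∤encode m r R z)
  ... | i , k , i< , e = no-acceptance Holds closed disjoint h (≡.subst Holds (state j)
    (closed (rule f (there (∈-map⁺ _ (∈-upTo⁺ i<)))) k (≡.subst Holds (≡.sym (state pc)) holds)))
    where
    state : ∀ p → M * sylvester r * k + (M * suc i + p) ≡ M * encode m R + p
    state p = ≡.trans (rotate M (sylvester r) k (suc i) p) (≡.cong (λ n → M * n + p) (≡.sym e))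
  no-acceptance Holds closed disjoint {pc} {R} (dec-suc {r} {j} {l} {R′} f i h) holds =
    no-acceptance Holds closed disjoint h (closed (rule f (here ≡.refl)) (encode m R′)
      (≡.subst Holds (≡.trans (≡.cong (λ n → M * n + pc) (encode-Increment m R′ R (<m f) i))
        (≡.sym (regroup M (sylvester r) (encode m R′) pc))) holds))

  trace : ∀ {o pc R} → Halts Q o pc R → List ℕ
  trace {pc = pc} {R} (halted _ _)     = code pc R ∷ []
  trace {pc = pc} {R} (inc-step _ _ h) = code pc R ∷ trace h
  trace {pc = pc} {R} (dec-zero _ _ h) = code pc R ∷ trace h
  trace {pc = pc} {R} (dec-suc _ _ h)  = code pc R ∷ trace h

  code∈trace : ∀ {o pc R} (h : Halts Q o pc R) → code pc R ∈ trace h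
  code∈trace (halted _ _)     = here ≡.refl
  code∈trace (inc-step _ _ h) = here ≡.refl
  code∈trace (dec-zero _ _ h) = here ≡.refl
  code∈trace (dec-suc _ _ h)  = here ≡.refl

  private
    pc≤L : ∀ {pc ins} → fetch Q pc ≡ just ins → pc ≤ L
    pc≤L e = ℕ.<⇒≤ (fetch-just⇒< Q e)

    same : ∀ {pc i j} → fetch Q pc ≡ just i → fetch Q pc ≡ just j → i ≡ j
    same e f = just-injective (≡.trans (≡.sym e) f)

    not-at-end : ∀ {pc i} → fetch Q pc ≡ just i → ¬ pc ≡ L
    not-at-end {pc} {i} e ≡.refl with ≡.trans (≡.sym e) (fetch-length Q)
    ... | ()

    data Applicable (pc : ℕ) (R : Registers) (β : Affine) (k : ℕ) : Set where
      by-inc : ∀ {r j} → fetch Q pc ≡ just (inc r j) →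
               β $ₐ k ≡ M * (sylvester r * encode m R) + j → Applicable pc R β k
      by-suc : ∀ {r j l} → fetch Q pc ≡ just (dec r j l) → encode m R ≡ sylvester r * k →
               β $ₐ k ≡ M * k + l → Applicable pc R β k
      by-zero : ∀ {r j l} → fetch Q pc ≡ just (dec r j l) → ¬ sylvester r ∣ encode m R →
               β $ₐ k ≡ code j R → Applicable pc R β k

    -- As pc ≤ L < M, a code determines both the address and the code of the registers; a rule
    -- matching it therefore stems from the instruction at pc.
    applicable : ∀ {α β pc} R → (α , β) ∈ rules → ∀ k → pc ≤ L → α $ₐ k ≡ code pc R →
                 Applicable pc R β k
    applicable R ρ∈ k pc≤ e with ∈-rulesFrom⁻ Q 0 ρ∈
    applicable R ρ∈ k pc≤ e | pc′ , inc r j , f , here ≡.refl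
      with euclid-unique k (encode m R) (pc≤L f) pc≤ e
    ... | ≡.refl , ≡.refl = by-inc f (regroup M (sylvester r) k j)
    applicable R ρ∈ k pc≤ e | pc′ , dec r j l , f , here ≡.refl
      with euclid-unique (sylvester r * k) (encode m R) (pc≤L f) pc≤
             (≡.trans (≡.sym (regroup M (sylvester r) k pc′)) e)
    ... | ≡.refl , e′ = by-suc f (≡.sym e′) ≡.refl
    applicable R ρ∈ k pc≤ e | pc′ , dec r j l , f , there ρ∈′ with ∈-map⁻ _ ρ∈′
    ... | i , i∈ , ≡.refl
      with euclid-unique (sylvester r * k + suc i) (encode m R) (pc≤L f) pc≤
             (≡.trans (≡.sym (rotate M (sylvester r) k (suc i) pc′)) e)
    ... | ≡.refl , e′ = by-zero f
      (λ d → ℕ.<⇒≱ (s≤s (∈-upTo⁻ i∈)) (∣⇒≤ (∣m+n∣m⇒∣n (≡.subst (sylvester r ∣_) (≡.sym e′) d) (m∣m*n k))))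
      (≡.trans (rotate M (sylvester r) k (suc i) j) (≡.cong (λ n → M * n + j) e′))

    divisible : ∀ {r R R′ pc ins} → fetch Q pc ≡ just ins → register ins ≡ r → Increment r R′ R →
                sylvester r ∣ encode m R
    divisible {r} {R} {R′} f ≡.refl i =
      divides (encode m R′) (≡.trans (encode-Increment m R′ R (<m f) i) (ℕ.*-comm (sylvester r) (encode m R′)))

  -- Required for `member⁻`, where t must divide the monomial.
  rules-positive : ∀ {α β} → (α , β) ∈ rules → 1 ≤ proj₁ α
  rules-positive ρ∈ with ∈-rulesFrom⁻ Q 0 ρ∈
  ... | _ , inc r j   , _ , here ≡.refl = s≤s z≤n
  ... | _ , dec r j l , _ , here ≡.refl = s≤s z≤n
  ... | _ , dec r j l , _ , there ρ∈′ with ∈-map⁻ _ ρ∈′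
  ... | _ , _ , ≡.refl = s≤s z≤n

  -- The rules are deterministic on codes of states: divisibility by the base separates the two
  -- branches of `dec`, so a matching rule leads to the next code of the trace. No instruction,
  -- hence no rule, belongs to the final address.
  trace-closed : ∀ {o pc R α β} (h : Halts Q o pc R) → (α , β) ∈ rules → ∀ k →
                 α $ₐ k ∈ trace h → β $ₐ k ∈ trace h
  trace-closed {R = R} (halted pc≡L _) ρ∈ k (here e) with applicable R ρ∈ k (ℕ.≤-reflexive pc≡L) e
  ... | by-inc f _    = ⊥-elim (not-at-end f pc≡L)
  ... | by-suc f _ _  = ⊥-elim (not-at-end f pc≡L)
  ... | by-zero f _ _ = ⊥-elim (not-at-end f pc≡L)
  trace-closed (inc-step f i h) ρ∈ k (there a) = there (trace-closed h ρ∈ k a)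
  trace-closed (dec-zero f z h) ρ∈ k (there a) = there (trace-closed h ρ∈ k a)
  trace-closed (dec-suc f i h)  ρ∈ k (there a) = there (trace-closed h ρ∈ k a)
  trace-closed {R = R} (inc-step {R′ = R′} f i h) ρ∈ k (here e) with applicable R ρ∈ k (pc≤L f) e
  ... | by-suc g _ _  with () ← same f g
  ... | by-zero g _ _ with () ← same f g
  ... | by-inc {r} {j} g e′ with ≡.refl ← same f g = there (≡.subst (_∈ trace h)
    (≡.trans (≡.cong (λ n → M * n + j) (encode-Increment m R R′ (<m f) i)) (≡.sym e′)) (code∈trace h))
  trace-closed {R = R} (dec-zero f z h) ρ∈ k (here e) with applicable R ρ∈ k (pc≤L f) e
  ... | by-inc g _    with () ← same f g
  ... | by-zero g _ e′ with ≡.refl ← same f g = there (≡.subst (_∈ trace h) (≡.sym e′) (code∈trace h))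
  ... | by-suc {r} g d _ with ≡.refl ← same f g =
    ⊥-elim (sylvester∤encode m r R z (divides k (≡.trans d (ℕ.*-comm (sylvester r) k))))
  trace-closed {R = R} (dec-suc {l = l} {R′ = R′} f i h) ρ∈ k (here e) with applicable R ρ∈ k (pc≤L f) e
  ... | by-inc g _     with () ← same f g
  ... | by-zero g ∤ _  with ≡.refl ← same f g = ⊥-elim (∤ (divisible {R = R} {R′} f ≡.refl i))
  ... | by-suc {r} g d e′ with ≡.refl ← same f g = there (≡.subst (_∈ trace h)
    (≡.trans (≡.cong (λ n → M * n + l)
      (ℕ.*-cancelˡ-≡ (encode m R′) k (sylvester r) (≡.trans (≡.sym (encode-Increment m R′ R (<m f) i)) d)))
      (≡.sym e′))
    (code∈trace h))

  private
    code-accept : ∀ k {pc R} → pc ≤ L → accept $ₐ k ≡ code pc R →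
                  pc ≡ L × encode m R ≡ 2 * (2 * k + 1)
    code-accept k {pc} {R} pc≤ e
      with euclid-unique (2 * (2 * k + 1)) (encode m R) ℕ.≤-refl pc≤ (≡.trans (≡.sym (accept-code k)) e)
    ... | L≡pc , e′ = ≡.sym L≡pc , ≡.sym e′

    2∤odd : ∀ k → ¬ 2 ∣ 2 * k + 1
    2∤odd k d with () ← ∣1⇒≡1 (∣m+n∣m⇒∣n d (m∣m*n k))

    -- Register 0 counts the factors 2 of the code: content 0 would make it odd, content 2 or more
    -- divisible by 4.
    register-0≡1 : ∀ k R → encode m R ≡ 2 * (2 * k + 1) → R 0 ≡ 1
    register-0≡1 k R e with R 0 in eq
    ... | zero  = ⊥-elim (sylvester∤encode m 0 R eq
      (divides (2 * k + 1) (≡.trans e (ℕ.*-comm 2 (2 * k + 1)))))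
    ... | suc zero = ≡.refl
    ... | suc (suc v) = ⊥-elim (2∤odd k (divides (encode m R″) (≡.trans
      (ℕ.*-cancelˡ-≡ (2 * k + 1) (2 * encode m R″) 2 (≡.trans (≡.sym e)
        (≡.trans (encode-Increment m R′ R (s≤s z≤n) (decrement R eq))
          (≡.cong (2 *_) (encode-Increment m R″ R′ (s≤s z≤n) (decrement R′ (update-same R 0 (suc v))))))))
      (ℕ.*-comm 2 (encode m R″)))))
      where
      R′ R″ : Registers
      R′ = update R 0 (suc v)
      R″ = update R′ 0 v

  -- Accepting codes have address L, which in a trace occurs only in the final state.
  accept∈trace : ∀ {o pc R} (h : Halts Q o pc R) → ∀ k → accept $ₐ k ∈ trace h → o ≡ 1
  accept∈trace (inc-step f i h) k (there a) = accept∈trace h k a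
  accept∈trace (dec-zero f z h) k (there a) = accept∈trace h k a
  accept∈trace (dec-suc f i h)  k (there a) = accept∈trace h k a
  accept∈trace {R = R} (inc-step f i h) k (here e) =
    ⊥-elim (not-at-end f (proj₁ (code-accept k {R = R} (pc≤L f) e)))
  accept∈trace {R = R} (dec-zero f z h) k (here e) =
    ⊥-elim (not-at-end f (proj₁ (code-accept k {R = R} (pc≤L f) e)))
  accept∈trace {R = R} (dec-suc f i h) k (here e) =
    ⊥-elim (not-at-end f (proj₁ (code-accept k {R = R} (pc≤L f) e)))
  accept∈trace {R = R} (halted pc≡L R0≡o) k (here e) = ≡.trans (≡.sym R0≡o)
    (register-0≡1 k R (proj₂ (code-accept k {R = R} (ℕ.≤-reflexive pc≡L) e)))

-- The self-referential sentence and undecidability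

-- The sentence asserting that P does not output 1 on the number of this very sentence.
module SelfReference (P : Program) where
  open Simulation (substitution then P)

  -- Abstract because ⌜ θ ⌝ must not be evaluated.
  abstract
    θ : Formula 2
    θ = separatorF M rules accept

    θ-unfold : θ ≡ separatorF M rules accept
    θ-unfold = ≡.refl

  sentence : Sentence
  sentence = substitute θ ⌜ θ ⌝

  private
    input : ℕ → List ℕ
    input n = n ∷ 0 ∷ 0 ∷ 0 ∷ 0 ∷ 0 ∷ 0 ∷ []

    input-padding : ∀ n s → ⟨ input n ⟩ (suc s) ≡ 0
    input-padding n zero = ≡.refl
    input-padding n (suc zero) = ≡.refl
    input-padding n (suc (suc zero)) = ≡.refl
    input-padding n (suc (suc (suc zero))) = ≡.refl
    input-padding n (suc (suc (suc (suc zero)))) = ≡.refl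
    input-padding n (suc (suc (suc (suc (suc zero))))) = ≡.refl
    input-padding n (suc (suc (suc (suc (suc (suc s)))))) = ≡.refl

    halts : ∀ n k {o} → run P k (diagonalNumber n) ≡ just o → Halts (substitution then P) o 0 ⟨ input n ⟩
    halts n k = then-halts substitution P {k} (substitution⇓ n) λ where
      zero    → ≡.refl
      (suc s) → input-padding (diagonalNumber n) s

    initial-code : ∀ n → code 0 ⟨ input n ⟩ ≡ M * 2 ^ n
    initial-code n = code-input ⟨ input n ⟩ (input-padding n)

  module _ {c ℓ x : Level} (K : Field c ℓ) (X : Set x) where
    open Semantics (𝔸-structure K X)
    open SeparatorSemantics K X

    accepted⇒false : ∀ n k → run P k (diagonalNumber n) ≡ just 1 → ¬ Th (substitute θ n)
    accepted⇒false n k r th = no-acceptance Holds closed disjoint (halts n k r)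
      (≡.subst Holds (≡.sym (initial-code n)) initial)
      where open Separator (separatorF-sound M rules accept n
              (≡.subst (λ θ → Th (substitute θ n)) θ-unfold th))

    rejected⇒true : X → ∀ n k {o} → run P k (diagonalNumber n) ≡ just o → ¬ o ≡ 1 →
                    Th (substitute θ n)
    rejected⇒true y n k r o≢1 = ≡.subst (λ θ → Th (substitute θ n)) (≡.sym θ-unfold)
      (Complete.separatorF-complete y (trace h) M rules accept n
      (≡.subst (_∈ trace h) (initial-code n) (code∈trace h))
      (λ ρ∈ → rules-positive ρ∈ , trace-closed h ρ∈)
      (s≤s z≤n) (λ j a → o≢1 (accept∈trace h j a)))
      where
      h : Halts (substitution then P) _ 0 ⟨ input n ⟩
      h = halts n k r

theorem7p1 : ∀ {c ℓ x : Level} (K : Field c ℓ) (X : Set x) → X →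
    ¬ DecidableTheory (Semantics.Th (𝔸-structure K X))
theorem7p1 K X y (P , decides) = contradictory (decides sentence)
  where
  open SelfReference P
  open Semantics (𝔸-structure K X) using (Th)
  contradictory : ¬ (Σ ℕ λ k → Σ ℕ λ o →
    (run P k ⌜ sentence ⌝ ≡ just o) × ((o ≡ 1 → Th sentence) × (Th sentence → o ≡ 1)))
  contradictory (k , o , r , accepted , true) with o ℕ.≟ 1
  ... | yes ≡.refl = accepted⇒false K X ⌜ θ ⌝ k
    (≡.subst (λ n → run P k n ≡ just 1) (substitute-code θ) r) (accepted ≡.refl)
  ... | no o≢1 = o≢1 (true (rejected⇒true K X y ⌜ θ ⌝ k
    (≡.subst (λ n → run P k n ≡ just o) (substitute-code θ) r) o≢1))
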